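{- Let $m_1,\ldots,m_n$ be positive integers, let $k$ be a positive integer, and let $A$ be the set of $k$-ary words (words over $\{1,\ldots,k\}$) avoiding the vincular pattern $\tau=1^{m_1}\text{ - }1^{m_2}\text{ - }\cdots\text{ - }1^{m_n}$. Then \[ \sum_{a_1\cdots a_l\in A} x_{a_1}x_{a_2}\cdots x_{a_l} = \Phi\!\left(\prod_{i=1}^k\Big[e^{tx_i} - T\{G_\tau(x_i,u)\}\Big]\right), \] where \[ G_\tau(x,u)=\frac{u x^{m_1}(1-x)}{\big(1-x-u(x-x^{m_1})\big)\big(1-x-ux\big)}\prod_{i=2}^n\left[x^{m_i}+\frac{u x^{m_i}(1-x^{m_i})}{1-x-u(x-x^{m_i})}\right]. \]
   Context: A word $s_1\cdots s_l$ contains the pattern $1^{m_1}\text{ - }\cdots\text{ - }1^{m_n}$ (with $m=m_1+\cdots+m_n$) if there are indices $1\le i_1<\cdots<i_m\le l$ with $s_{i_1}=\cdots=s_{i_m}$ and $i_{j+1}-i_j=1$ for every $j\notin\{m_1,m_1+m_2,\ldots,m_1+\cdots+m_{n-1}\}$; otherwise it avoids the pattern. The polynomials $l_k(t)$ are defined by $\sum_{k\ge0} l_k(t)y^k=\exp\!\left(\frac{ty}{1+y}\right)$. $T$ is the linear transformation sending $u^k\mapsto l_k(t)$ for each $k\ge 0$, applied to power series in $u$ whose coefficients are formal power series in the other variables (coefficientwise in those variables). $\Phi$ is the linear operator with $\Phi(t^n)=n!$ which fixes all other variables, applied coefficientwise to formal power series in $x_1,\ldots,x_k$ whose coefficients are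 polynomials in $t$. -}

module Defs where

open import Data.Nat as ℕ using (ℕ; zero; suc; _∸_; _!)
open import Data.Nat.Properties using (_!≢0)
open import Data.Nat.ListAction using () renaming (sum to sumℕ)
open import Data.Integer using (+_)
open import Data.Rational using (ℚ; 0ℚ; 1ℚ; _/_; _+_; _*_; _-_; -_)
open import Data.Fin as Fin using (Fin; toℕ)
open import Data.List as List using (List; []; _∷_; length; map; foldr; filter; concatMap; upTo; lookup)
open import Data.List.Membership.Propositional using (_∉_)
open import Data.Vec as Vec using (Vec; []; _∷_; zipWith; _[_]≔_)
open import Data.Bool using (Bool; true; false; _∧_; if_then_else_)
open import Data.Product using (Σ; _×_)
open import Relation.Binary.PropositionalEquality using (_≡_)
open import Relation.Nullary using (¬_; Dec; yes; no)
open import Relation.Nullary.Decidable using (_×-dec_)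
open import Data.Vec.Properties using (≡-dec)

-- Words and the vincular pattern 1^{m_1}-...-1^{m_n}
-- A pattern is the list (m_1 ∷ ... ∷ m_n).  A k-ary word is a List (Fin k).

patLen : List ℕ → ℕ
patLen = sumℕ

boundariesFrom : ℕ → List ℕ → List ℕ
boundariesFrom acc []            = []
boundariesFrom acc (m ∷ [])      = []
boundariesFrom acc (m ∷ m' ∷ ms) = (acc ℕ.+ m) ∷ boundariesFrom (acc ℕ.+ m) (m' ∷ ms)

boundaries : List ℕ → List ℕ
boundaries = boundariesFrom 0

-- Contains w τ: there are indices i_1 < ... < i_m (here i : Fin m → Fin (length w),
-- 0-based) with all letters equal and i_{j+1} - i_j = 1 whenever the 1-based
-- index j is not a boundary.
Contains : {k : ℕ} → List ℕ → List (Fin k) → Set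
Contains {k} τ w =
  Σ (Fin (patLen τ) → Fin (length w)) λ i →
    (∀ j j' → j Fin.< j' → i j Fin.< i j')
  × (∀ j j' → lookup w (i j) ≡ lookup w (i j'))
  × (∀ (j j' : Fin (patLen τ)) → toℕ j' ≡ suc (toℕ j) → suc (toℕ j) ∉ boundaries τ
       → toℕ (i j') ≡ suc (toℕ (i j)))

Avoids : {k : ℕ} → List ℕ → List (Fin k) → Set
Avoids τ w = ¬ Contains τ w

allWords : (k l : ℕ) → List (List (Fin k))
allWords k zero    = [] ∷ []
allWords k (suc l) = concatMap (λ c → map (c ∷_) (allWords k l)) (List.allFin k)

occ : {k : ℕ} → Fin k → List (Fin k) → ℕ
occ c [] = 0
occ c (a ∷ w) with c Fin.≟ a
... | yes _ = suc (occ c w)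
... | no  _ = occ c w

content : {k : ℕ} → List (Fin k) → Vec ℕ k
content w = Vec.tabulate (λ c → occ c w)

-- coefficient of x^α in  Σ_{a ∈ A} x_{a_1}...x_{a_l},  A = words avoiding τ
-- (all such words have length Σ α).  Uses any decision procedure for avoidance.
lhsCoeff : {k : ℕ} (τ : List ℕ) → (∀ (w : List (Fin k)) → Dec (Avoids τ w)) → Vec ℕ k → ℕ
lhsCoeff {k} τ dec α =
  length (filter (λ w → dec w ×-dec ≡-dec ℕ._≟_ (content w) α) (allWords k (Vec.sum α)))

ℕtoℚ : ℕ → ℚ
ℕtoℚ n = + n / 1

invFact : ℕ → ℚ
invFact n = (+ 1 / (n !)) {{n !≢0}}

sumTo : ℕ → (ℕ → ℚ) → ℚ
sumTo zero    f = f 0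
sumTo (suc n) f = sumTo n f + f (suc n)

-- Polynomials in t : coefficient lists (constant term first)

Poly : Set
Poly = List ℚ

_p+_ : Poly → Poly → Poly
[] p+ q = q
(a ∷ p) p+ [] = a ∷ p
(a ∷ p) p+ (b ∷ q) = (a + b) ∷ (p p+ q)

pscale : ℚ → Poly → Poly
pscale c = map (c *_)

_p*_ : Poly → Poly → Poly
[] p* q = []
(a ∷ p) p* q = pscale a q p+ (0ℚ ∷ (p p* q))

p- : Poly → Poly
p- = map (λ c → - c)

monomial : ℕ → ℚ → Poly
monomial zero    c = c ∷ []
monomial (suc n) c = 0ℚ ∷ monomial n c

psum : List Poly → Poly
psum = foldr _p+_ []

Φ : Poly → ℚ
Φ p = go 0 p
  where
  go : ℕ → Poly → ℚ
  go n []      = 0ℚ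
  go n (a ∷ q) = a * ℕtoℚ (n !) + go (suc n) q

-- Univariate formal power series (in y) over ℚ, as coefficient functions

Ser1 : Set
Ser1 = ℕ → ℚ

_1*_ : Ser1 → Ser1 → Ser1
(f 1* g) n = sumTo n (λ i → f i * g (n ∸ i))

_1^_ : Ser1 → ℕ → Ser1
f 1^ zero  = λ { zero → 1ℚ ; (suc _) → 0ℚ }
f 1^ suc j = f 1* (f 1^ j)

-- inverse of a series with constant term 1:  1/f = Σ_j (1 - f)^j
inv1 : Ser1 → Ser1
inv1 f n = sumTo n (λ j → ((λ i → oneMinus i) 1^ j) n)
  where
  oneMinus : ℕ → ℚ
  oneMinus zero    = 1ℚ - f 0
  oneMinus (suc i) = - f (suc i)

yOver1py : Ser1
yOver1py = (λ { 1 → 1ℚ ; _ → 0ℚ }) 1* inv1 (λ { 0 → 1ℚ ; 1 → 1ℚ ; _ → 0ℚ })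

-- l_k(t) = [y^k] exp(t y/(1+y)) = Σ_j t^j/j! [y^k] (y/(1+y))^j
-- (only j ≤ k contribute since y/(1+y) has zero constant term)
lpoly : ℕ → Poly
lpoly k = go k
  where
  go : ℕ → Poly
  go zero    = monomial 0 ((yOver1py 1^ 0) k)
  go (suc j) = go j p+ monomial (suc j) (invFact (suc j) * (yOver1py 1^ suc j) k)

-- Bivariate formal power series in x, u over ℚ:  f a b = [x^a u^b] f

Ser2 : Set
Ser2 = ℕ → ℕ → ℚ

_2+_ : Ser2 → Ser2 → Ser2
(f 2+ g) a b = f a b + g a b

_2-_ : Ser2 → Ser2 → Ser2
(f 2- g) a b = f a b - g a b

_2*_ : Ser2 → Ser2 → Ser2
(f 2* g) a b = sumTo a (λ c → sumTo b (λ d → f c d * g (a ∸ c) (b ∸ d)))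

one2 : Ser2
one2 zero zero = 1ℚ
one2 _    _    = 0ℚ

X : Ser2
X 1 0 = 1ℚ
X _ _ = 0ℚ

U : Ser2
U 0 1 = 1ℚ
U _ _ = 0ℚ

_2^_ : Ser2 → ℕ → Ser2
f 2^ zero  = one2
f 2^ suc j = f 2* (f 2^ j)

-- inverse of a series with constant term 1:  1/f = Σ_j (1 - f)^j
-- (the coefficient of x^a u^b only receives contributions from j ≤ a + b)
inv2 : Ser2 → Ser2
inv2 f a b = sumTo (a ℕ.+ b) (λ j → ((one2 2- f) 2^ j) a b)

Dm : ℕ → Ser2
Dm m = (one2 2- X) 2- (U 2* (X 2- (X 2^ m)))

D0 : Ser2
D0 = (one2 2- X) 2- (U 2* X)

bracket : ℕ → Ser2
bracket m = (X 2^ m) 2+ (((U 2* (X 2^ m)) 2* (one2 2- (X 2^ m))) 2* inv2 (Dm m))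

G : ℕ → List ℕ → Ser2
G m₁ ms =
  ((((U 2* (X 2^ m₁)) 2* (one2 2- X)) 2* inv2 (Dm m₁)) 2* inv2 D0)
  2* foldr (λ m acc → bracket m 2* acc) one2 ms

-- T applied to a bivariate series: [x^a] T{f} = Σ_b ([x^a u^b] f) l_b(t).
-- For f = G_τ, [x^a u^b] G_τ = 0 for b > a (every u comes with at least one x),
-- so the sum is over b ≤ a.
TG : ℕ → List ℕ → ℕ → Poly
TG m₁ ms a = psum (List.map (λ b → pscale (G m₁ ms a b) (lpoly b)) (upTo (suc a)))

factorCoeff : ℕ → List ℕ → ℕ → Poly
factorCoeff m₁ ms a = monomial a (invFact a) p+ p- (TG m₁ ms a)

-- Formal power series in x_1..x_k with coefficients in ℚ[t]:
-- coefficient of x^α for α : Vec ℕ k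

MSer : ℕ → Set
MSer k = Vec ℕ k → Poly

below : {k : ℕ} → Vec ℕ k → List (Vec ℕ k)
below []      = [] ∷ []
below (a ∷ α) = concatMap (λ c → map (c ∷_) (below α)) (upTo (suc a))

_m*_ : {k : ℕ} → MSer k → MSer k → MSer k
(f m* g) α = psum (map (λ β → f β p* g (zipWith _∸_ α β)) (below α))

isZeroVec : {k : ℕ} → Vec ℕ k → Bool
isZeroVec []          = true
isZeroVec (zero ∷ α)  = isZeroVec α
isZeroVec (suc _ ∷ α) = false

mone : {k : ℕ} → MSer k
mone α = if isZeroVec α then 1ℚ ∷ [] else []

embed : {k : ℕ} → Fin k → (ℕ → Poly) → MSer k
embed i F α = if isZeroVec (α [ i ]≔ 0) then F (Vec.lookup α i) else []

rhsProduct : (k : ℕ) → ℕ → List ℕ → MSer k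
rhsProduct k m₁ ms = foldr (λ i acc → embed i (factorCoeff m₁ ms) m* acc) mone (List.allFin k)

rhsCoeff : (k : ℕ) → ℕ → List ℕ → Vec ℕ k → ℚ
rhsCoeff k m₁ ms α = Φ (rhsProduct k m₁ ms α)

{-# OPTIONS --safe #-}
-- Read a word from left to right.  For each letter, whether the pattern occurs in it depends only on
-- the lengths of the runs of that letter, and is decided by a small automaton that matches the blocks
-- greedily.  Let A(x,u) = Σ x^a u^b count the run-length sequences of total length a with b runs that
-- lead the automaton to acceptance, and E(x,u) those that may first extend a run in progress.
--
-- From Σ l_k y^k = exp(ty/(1+y)) one gets l'_{k+1} + l'_k = l_k.  Let T' send u^b to l'_{b+1}; then
-- (T A)' and T'E satisfy the recurrences that A and E obtain from reading one letter.  Together with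
-- Φ(p) = p(0) + Φ(p') (integration by parts) and the Leibniz rule this shows, by induction on the
-- length, that Φ(∏ T A_i) counts the words accepted by all the automata, with no reference to words
-- without equal adjacent letters.  If everything is accepted then T A = e^{tx}; if the words in which
-- the pattern was completed are accepted, the equations for A and E have the solution A = G_τ.
-- The difference of the two is the factor e^{tx} - T{G_τ} for avoidance.
module Submission where

open import Defs
open import Algebra using (CommutativeRing; RawRing)
open import Algebra.Morphism.Structures using (IsRingMonomorphism)
import Algebra.Morphism.RingMonomorphism as RingMono
open import Data.Bool using (Bool; true; false; if_then_else_)
open import Data.Empty using (⊥; ⊥-elim)
open import Data.Fin as Fin using (Fin; zero; suc; toℕ)
open import Data.Fin.Properties using (any?; toℕ-inject₁; ¬∀⟶∃¬)
import Data.Integer as ℤ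
import Data.Integer.Properties as ℤₚ
open import Data.List using (List; []; _∷_; _++_; map; foldr; filter; length; lookup; tabulate; concatMap; applyUpTo; upTo)
open import Data.List.Membership.Propositional using (_∈_; _∉_)
open import Data.List.Properties using (map-upTo)
open import Data.List.Relation.Unary.All using (All; []; _∷_)
open import Data.List.Relation.Unary.Any using (here; there)
open import Data.Maybe using (Maybe; just; nothing)
open import Data.Nat as ℕ using (ℕ; zero; suc; pred; _∸_; _!; _≤_; _<_; z≤n; s≤s; NonZero)
open import Data.Nat.ListAction using () renaming (sum to sumℕ)
open import Data.Nat.Properties as ℕₚ using (_!≢0; ≤-refl; ≤-<-trans; m≤n⇒m≤1+n)
open import Data.Product using (∃; _×_; _,_; proj₁; proj₂)
import Data.Rational.Unnormalised as ℚᵘ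
import Data.Rational.Unnormalised.Properties as ℚᵘₚ
open import Data.Sum using (_⊎_; inj₁; inj₂)
open import Data.Vec as Vec using (Vec; []; _∷_; zipWith; _[_]≔_)
open import Data.Vec.Functional using (updateAt)
open import Data.Vec.Functional.Properties using (updateAt-updates; updateAt-minimal)
open import Data.Vec.Properties using (≡-dec; lookup∘tabulate; tabulate∘lookup; tabulate-cong)
open import Function using (_∘_; const)
open import Relation.Nullary using (¬_; Dec; yes; no; does; contradiction)
open import Relation.Nullary.Decidable using (_×-dec_; dec-true; dec-false)

-- Formal power series

-- Letters do not act independently: two runs of one letter never touch. The only memory this
-- requires is the preceding letter `p`, and it affects only the factor of `p`. Integration by parts
-- turns `Φ(∏ T A_x)` into a constant (the empty word) plus one summand for each first letter `c`,
-- in which `T A_c` is replaced by its derivative `x T'E(new)`. At the next letter the run of `c` is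
-- still open, so another `c` must extend it, whereas differentiating a plain `T A_c` would open a
-- second run. The identity `T'E + (T A)' = T A + x T'E(ext)` repairs exactly this summand: it
-- exchanges the continuation by a new run for the continuation by an extension and leaves the other
-- letters alone. Hence the shift in `T'`, which makes `(T(u F))' = T'F`, and the need to carry `E`
-- beside `A`.

module PowerSeries {c ℓ} (R : CommutativeRing c ℓ) where
  open CommutativeRing R
  open import Relation.Binary.Reasoning.Setoid setoid
  open import Algebra.Properties.CommutativeSemigroup +-commutativeSemigroup
    using (x∙yz≈y∙xz; interchange)

  Series : Set c
  Series = ℕ → Carrier

  tail : Series → Series
  tail f n = f (suc n)

  infix 4 _≐_
  _≐_ : Series → Series → Set ℓ
  f ≐ g = ∀ n → f n ≈ g n

  infixl 7 _⊛_ _·_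
  infixl 6 _⊕_
  _⊕_ : Series → Series → Series
  (f ⊕ g) n = f n + g n

  ⊖_ : Series → Series
  (⊖ f) n = - f n

  _·_ : Carrier → Series → Series
  (a · f) n = a * f n

  𝟘 : Series
  𝟘 n = 0#

  𝟙 : Series
  𝟙 zero    = 1#
  𝟙 (suc n) = 0#

  -- Recursion on the first factor, instead of a sum over splittings, makes each ring law a
  -- structural induction free of truncated subtraction. `⊛-sum≤` recovers the convolution.
  _⊛_ : Series → Series → Series
  (f ⊛ g) zero    = f 0 * g 0
  (f ⊛ g) (suc n) = f 0 * g (suc n) + (tail f ⊛ g) n

  sum≤ : ℕ → (ℕ → Carrier) → Carrier
  sum≤ zero    f = f 0
  sum≤ (suc n) f = sum≤ n f + f (suc n)

  sum≤-front : ∀ n f → sum≤ (suc n) f ≈ f 0 + sum≤ n (λ i → f (suc i))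
  sum≤-front zero    f = refl
  sum≤-front (suc n) f = begin
    sum≤ (suc n) f + f (suc (suc n))                     ≈⟨ +-congʳ (sum≤-front n f) ⟩
    f 0 + sum≤ n (λ i → f (suc i)) + f (suc (suc n))     ≈⟨ +-assoc _ _ _ ⟩
    f 0 + (sum≤ n (λ i → f (suc i)) + f (suc (suc n)))   ∎

  sum≤-cong : ∀ n {f g} → (∀ i → f i ≈ g i) → sum≤ n f ≈ sum≤ n g
  sum≤-cong zero    e = e 0
  sum≤-cong (suc n) e = +-cong (sum≤-cong n e) (e (suc n))

  ⊛-sum≤ : ∀ n f g → sum≤ n (λ i → f i * g (n ∸ i)) ≈ (f ⊛ g) n
  ⊛-sum≤ zero    f g = refl
  ⊛-sum≤ (suc n) f g = trans (sum≤-front n (λ i → f i * g (suc n ∸ i))) (+-congˡ (⊛-sum≤ n (tail f) g))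

  -- Inverses are available only through partial geometric sums, which are correct up to some
  -- degree; a product at `n` looks no further than `n`.
  ⊛-local : ∀ n {f f′ g g′} → (∀ i → i ℕ.≤ n → f i ≈ f′ i) → (∀ i → i ℕ.≤ n → g i ≈ g′ i) →
            (f ⊛ g) n ≈ (f′ ⊛ g′) n
  ⊛-local zero    e e′ = *-cong (e 0 ℕ.z≤n) (e′ 0 ℕ.z≤n)
  ⊛-local (suc n) e e′ = +-cong (*-cong (e 0 ℕ.z≤n) (e′ (suc n) (≤-refl)))
    (⊛-local n (λ i le → e (suc i) (ℕ.s≤s le)) (λ i le → e′ i (m≤n⇒m≤1+n le)))

  ⊛-cong : ∀ {f f′ g g′} → f ≐ f′ → g ≐ g′ → f ⊛ g ≐ f′ ⊛ g′
  ⊛-cong e e′ n = ⊛-local n (λ i _ → e i) (λ i _ → e′ i)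

  ⊛-distribʳ : ∀ h f g → (f ⊕ g) ⊛ h ≐ (f ⊛ h) ⊕ (g ⊛ h)
  ⊛-distribʳ h f g zero    = distribʳ _ _ _
  ⊛-distribʳ h f g (suc n) = begin
    (f 0 + g 0) * h (suc n) + (tail (f ⊕ g) ⊛ h) n
      ≈⟨ +-cong (distribʳ _ _ _) (⊛-distribʳ h (tail f) (tail g) n) ⟩
    f 0 * h (suc n) + g 0 * h (suc n) + ((tail f ⊛ h) n + (tail g ⊛ h) n)
      ≈⟨ interchange _ _ _ _ ⟩
    f 0 * h (suc n) + (tail f ⊛ h) n + (g 0 * h (suc n) + (tail g ⊛ h) n) ∎

  ·-⊛ : ∀ a f g → (a · f) ⊛ g ≐ a · (f ⊛ g)
  ·-⊛ a f g zero    = *-assoc _ _ _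
  ·-⊛ a f g (suc n) = trans (+-cong (*-assoc _ _ _) (·-⊛ a (tail f) g n)) (sym (distribˡ _ _ _))

  ⊛-zeroˡ : ∀ f → 𝟘 ⊛ f ≐ 𝟘
  ⊛-zeroˡ f zero    = zeroˡ _
  ⊛-zeroˡ f (suc n) = trans (+-cong (zeroˡ _) (⊛-zeroˡ f n)) (+-identityˡ _)

  -- The defining recursion peels the first factor; peeling the second one is what closes the
  -- induction for `⊛-comm`.
  ⊛-last : ∀ f g n → (f ⊛ g) (suc n) ≈ f (suc n) * g 0 + (f ⊛ tail g) n
  ⊛-last f g zero    = +-comm _ _
  ⊛-last f g (suc n) = begin
    f 0 * g (suc (suc n)) + (tail f ⊛ g) (suc n)
      ≈⟨ +-congˡ (⊛-last (tail f) g n) ⟩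
    f 0 * g (suc (suc n)) + (f (suc (suc n)) * g 0 + (tail f ⊛ tail g) n)     ≈⟨ x∙yz≈y∙xz _ _ _ ⟩
    f (suc (suc n)) * g 0 + (f 0 * g (suc (suc n)) + (tail f ⊛ tail g) n)     ∎

  ⊛-comm : ∀ f g → f ⊛ g ≐ g ⊛ f
  ⊛-comm f g zero    = *-comm _ _
  ⊛-comm f g (suc n) = trans (+-cong (*-comm _ _) (⊛-comm (tail f) g n)) (sym (⊛-last g f n))

  ⊛-assoc : ∀ f g h → (f ⊛ g) ⊛ h ≐ f ⊛ (g ⊛ h)
  ⊛-assoc f g h zero    = *-assoc _ _ _
  ⊛-assoc f g h (suc n) = begin
    f 0 * g 0 * h (suc n) + (((f 0 · tail g) ⊕ (tail f ⊛ g)) ⊛ h) n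
      ≈⟨ +-cong (*-assoc _ _ _) (⊛-distribʳ h (f 0 · tail g) (tail f ⊛ g) n) ⟩
    f 0 * (g 0 * h (suc n)) + (((f 0 · tail g) ⊛ h) n + ((tail f ⊛ g) ⊛ h) n)
      ≈⟨ +-congˡ (+-cong (·-⊛ (f 0) (tail g) h n) (⊛-assoc (tail f) g h n)) ⟩
    f 0 * (g 0 * h (suc n)) + (f 0 * (tail g ⊛ h) n + (tail f ⊛ (g ⊛ h)) n)
      ≈⟨ +-assoc _ _ _ ⟨
    f 0 * (g 0 * h (suc n)) + f 0 * (tail g ⊛ h) n + (tail f ⊛ (g ⊛ h)) n
      ≈⟨ +-congʳ (distribˡ _ _ _) ⟨
    f 0 * (g ⊛ h) (suc n) + (tail f ⊛ (g ⊛ h)) n ∎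

  ⊛-identityˡ : ∀ f → 𝟙 ⊛ f ≐ f
  ⊛-identityˡ f zero    = *-identityˡ _
  ⊛-identityˡ f (suc n) = trans (+-cong (*-identityˡ _) (⊛-zeroˡ f n)) (+-identityʳ _)

  seriesRing : CommutativeRing c ℓ
  seriesRing = record
    { Carrier = Series ; _≈_ = _≐_ ; _+_ = _⊕_ ; _*_ = _⊛_ ; -_ = ⊖_ ; 0# = 𝟘 ; 1# = 𝟙
    ; isCommutativeRing = record
      { isRing = record
        { +-isAbelianGroup = record
          { isGroup = record
            { isMonoid = record
              { isSemigroup = record
                { isMagma = record
                  { isEquivalence = record
                    { refl = λ _ → refl ; sym = λ e n → sym (e n) ; trans = λ e e′ n → trans (e n) (e′ n) }
                  ; ∙-cong = λ e e′ n → +-cong (e n) (e′ n) }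
                ; assoc = λ f g h n → +-assoc (f n) (g n) (h n) }
              ; identity = (λ f n → +-identityˡ (f n)) , (λ f n → +-identityʳ (f n)) }
            ; inverse = (λ f n → -‿inverseˡ (f n)) , (λ f n → -‿inverseʳ (f n))
            ; ⁻¹-cong = λ e n → -‿cong (e n) }
          ; comm = λ f g n → +-comm (f n) (g n) }
        ; *-cong = ⊛-cong
        ; *-assoc = ⊛-assoc
        ; *-identity = ⊛-identityˡ , (λ f n → trans (⊛-comm f 𝟙 n) (⊛-identityˡ f n))
        ; distrib = (λ f g h n → trans (⊛-comm f (g ⊕ h) n)
                       (trans (⊛-distribʳ f g h n) (+-cong (⊛-comm g f n) (⊛-comm h f n))))
                  , ⊛-distribʳ }
      ; *-comm = ⊛-comm } }

  y : Series
  y (suc zero) = 1#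
  y _          = 0#

  y⊛-zero : ∀ f → (y ⊛ f) 0 ≈ 0#
  y⊛-zero f = zeroˡ _

  y⊛-suc : ∀ f n → (y ⊛ f) (suc n) ≈ f n
  y⊛-suc f n = trans (+-cong (zeroˡ _) (trans (⊛-cong {g = f} tail-y (λ _ → refl) n) (⊛-identityˡ f n))) (+-identityˡ _)
    where
    tail-y : tail y ≐ 𝟙
    tail-y zero    = refl
    tail-y (suc n) = refl

  pow : Carrier → ℕ → Carrier
  pow x zero    = 1#
  pow x (suc n) = x * pow x n

  -- Telescoping of `(1 - h)(1 + h + ... + h^n) = 1 - h^(n+1)`, freed of subtraction. It concerns
  -- elements of the coefficient ring, so univariate inverses use it through `𝕊²` and bivariate ones
  -- through `𝔾ₚ`.
  geometric : ∀ f h → f + h ≈ 1# → ∀ n → f * sum≤ n (pow h) + pow h (suc n) ≈ 1#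
  geometric f h e zero    = trans (sym (distribʳ 1# f h)) (trans (*-identityʳ _) e)
  geometric f h e (suc n) = begin
    f * (sum≤ n (pow h) + pow h (suc n)) + h * pow h (suc n)    ≈⟨ +-congʳ (distribˡ _ _ _) ⟩
    f * sum≤ n (pow h) + f * pow h (suc n) + h * pow h (suc n)  ≈⟨ +-assoc _ _ _ ⟩
    f * sum≤ n (pow h) + (f * pow h (suc n) + h * pow h (suc n)) ≈⟨ +-congˡ (distribʳ _ f h) ⟨
    f * sum≤ n (pow h) + (f + h) * pow h (suc n)
      ≈⟨ +-congˡ (trans (*-congʳ e) (*-identityˡ _)) ⟩
    f * sum≤ n (pow h) + pow h (suc n)                          ≈⟨ geometric f h e n ⟩
    1#                                                          ∎

  ⊛-order : ∀ {h g} j → h 0 ≈ 0# → (∀ i → i ℕ.< j → g i ≈ 0#) → ∀ n → n ℕ.< suc j → (h ⊛ g) n ≈ 0#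
  ⊛-order j e v zero    _          = trans (*-congʳ e) (zeroˡ _)
  ⊛-order {h} {g} j e v (suc n) (ℕ.s≤s lt) = trans (+-cong (trans (*-congʳ e) (zeroˡ _))
    (trans (⊛-local n {g′ = 𝟘} (λ _ _ → refl) (λ i le → v i (≤-<-trans le lt)))
      (trans (⊛-comm (tail h) 𝟘 n) (⊛-zeroˡ (tail h) n)))) (+-identityˡ _)

-- Solving the equations of one block in a commutative ring

module Blocks {c ℓ} (R : CommutativeRing c ℓ) where
  open CommutativeRing R
  open PowerSeries R using (pow)
  open import Relation.Binary.Reasoning.Setoid setoid
  open import Algebra.Properties.Group +-group using () renaming (∙-cancelʳ to +-cancelʳ)
  open import Algebra.Solver.Ring.NaturalCoefficients.Default commutativeSemiring
    using (solve; _:=_; _:+_; _:*_; con)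

  -‿split : ∀ a b → a - b + b ≈ a
  -‿split a b = trans (+-assoc a (- b) b) (trans (+-congˡ (-‿inverseˡ b)) (+-identityʳ a))

  inverse-unique : ∀ {a i e} → a * i ≈ 1# → a * e ≈ 1# → e ≈ i
  inverse-unique {a} {i} {e} ai ae = begin
    e            ≈⟨ *-identityʳ e ⟨
    e * 1#       ≈⟨ *-congˡ ai ⟨
    e * (a * i)  ≈⟨ solve 3 (λ e a i → e :* (a :* i) := (a :* e) :* i) refl e a i ⟩
    (a * e) * i  ≈⟨ *-congʳ ae ⟩
    1# * i       ≈⟨ *-identityˡ i ⟩
    i            ∎

  geom : Carrier → ℕ → Carrier
  geom x zero    = 1#
  geom x (suc r) = 1# + x * geom x r

  geom-sum : ∀ x d → d + x ≈ 1# → ∀ r → geom x r * d + pow x (suc r) ≈ 1#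
  geom-sum x d e zero    = trans (+-cong (*-identityˡ d) (*-identityʳ x)) e
  geom-sum x d e (suc r) = begin
    (1# + x * geom x r) * d + x * pow x (suc r)
      ≈⟨ solve 4 (λ x g d p → (con 1 :+ x :* g) :* d :+ x :* p := d :+ x :* (g :* d :+ p)) refl x (geom x r) d (pow x (suc r)) ⟩
    d + x * (geom x r * d + pow x (suc r))         ≈⟨ +-congˡ (*-congˡ (geom-sum x d e r)) ⟩
    d + x * 1#                                     ≈⟨ +-congˡ (*-identityʳ x) ⟩
    d + x                                          ≈⟨ e ⟩
    1#                                             ∎

  -- Here `e r` stands for a run in progress with `r + 1` letters of the block missing. The run may
  -- stop before any of them, at the same price `a` each time because the block then restarts;
  -- otherwise the block is completed and `e′` takes over.
  run-expansion : ∀ x a e′ (e : ℕ → Carrier) → e 0 ≈ a + x * e′ → (∀ r → e (suc r) ≈ a + x * e r) →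
                  ∀ r → e r ≈ a * geom x r + pow x (suc r) * e′
  run-expansion x a e′ e e0 es zero    = trans e0 (solve 3 (λ a x e → a :+ x :* e := a :* con 1 :+ (x :* con 1) :* e) refl a x e′)
  run-expansion x a e′ e e0 es (suc r) = begin
    e (suc r)                                          ≈⟨ es r ⟩
    a + x * e r                                        ≈⟨ +-congˡ (*-congˡ (run-expansion x a e′ e e0 es r)) ⟩
    a + x * (a * geom x r + pow x (suc r) * e′)
      ≈⟨ solve 5 (λ a x g p e → a :+ x :* (a :* g :+ p :* e) := a :* (con 1 :+ x :* g) :+ (x :* p) :* e) refl a x (geom x r) (pow x (suc r)) e′ ⟩
    a * (1# + x * geom x r) + (x * pow x (suc r)) * e′ ∎

  -- Dictionary: `d = 1 - x`, `p = x^m`, `q = 1 - x^m`, `s = 1 + x + ... + x^(m-1)`, and `i` is the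
  -- inverse of the denominator `den`; `a` and `e` are the series A and E of an untouched block of
  -- size m, `e′` is E of what follows it. The hypotheses are sums because the solver works in a
  -- semiring; the one difference `x - p` is treated as an atom.
  module _ {x u d p q den i s a e e′ : Carrier}
    (dx : d + x ≈ 1#) (qp : q + p ≈ 1#) (den-split : den + u * (x - p) ≈ d) (den-inv : den * i ≈ 1#)
    (sd : s * d + p ≈ 1#) (e≈ : e ≈ a * s + p * e′) (ue : u * e ≈ u * a + a) where

    private
      sd≈q : s * d ≈ q
      sd≈q = +-cancelʳ p (s * d) q (trans sd (sym qp))

      den-ux : den + u * x ≈ d + u * p
      den-ux = begin
        den + u * x                    ≈⟨ +-congˡ (*-congˡ (-‿split x p)) ⟨
        den + u * (x - p + p)
          ≈⟨ solve 4 (λ den u y p → den :+ u :* (y :+ p) := (den :+ u :* y) :+ u :* p) refl den u (x - p) p ⟩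
        den + u * (x - p) + u * p      ≈⟨ +-congʳ den-split ⟩
        d + u * p                      ∎

      den-uq : den + u * q ≈ d + u * d
      den-uq = +-cancelʳ (u * x) _ _ (begin
        den + u * q + u * x
          ≈⟨ solve 4 (λ den u q x → den :+ u :* q :+ u :* x := (den :+ u :* x) :+ u :* q) refl den u q x ⟩
        den + u * x + u * q            ≈⟨ +-congʳ den-ux ⟩
        d + u * p + u * q
          ≈⟨ solve 4 (λ d u p q → d :+ u :* p :+ u :* q := d :+ u :* (q :+ p)) refl d u p q ⟩
        d + u * (q + p)                ≈⟨ +-congˡ (*-congˡ (trans qp (sym dx))) ⟩
        d + u * (d + x)
          ≈⟨ solve 3 (λ d u x → d :+ u :* (d :+ x) := d :+ u :* d :+ u :* x) refl d u x ⟩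
        d + u * d + u * x              ∎)

      -- Elimination of `e` between `e≈` and `ue`: the factor `d` turns `s` into `q`, after which
      -- `u * q * a` cancels.
      den-a : den * a ≈ u * p * d * e′
      den-a = +-cancelʳ (u * q * a) _ _ (begin
        den * a + u * q * a
          ≈⟨ solve 4 (λ den a u q → den :* a :+ u :* q :* a := (den :+ u :* q) :* a) refl den a u q ⟩
        (den + u * q) * a              ≈⟨ *-congʳ den-uq ⟩
        (d + u * d) * a
          ≈⟨ solve 3 (λ d u a → (d :+ u :* d) :* a := d :* (u :* a :+ a)) refl d u a ⟩
        d * (u * a + a)                ≈⟨ *-congˡ ue ⟨
        d * (u * e)                    ≈⟨ *-congˡ (*-congˡ e≈) ⟩
        d * (u * (a * s + p * e′))
          ≈⟨ solve 6 (λ d u a s p e → d :* (u :* (a :* s :+ p :* e)) := u :* p :* d :* e :+ u :* (s :* d) :* a) refl d u a s p e′ ⟩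
        u * p * d * e′ + u * (s * d) * a ≈⟨ +-congˡ (*-congʳ (*-congˡ sd≈q)) ⟩
        u * p * d * e′ + u * q * a     ∎)

    block-new : a ≈ u * p * d * i * e′
    block-new = begin
      a                      ≈⟨ *-identityʳ a ⟨
      a * 1#                 ≈⟨ *-congˡ den-inv ⟨
      a * (den * i)          ≈⟨ solve 3 (λ a den i → a :* (den :* i) := (den :* a) :* i) refl a den i ⟩
      (den * a) * i          ≈⟨ *-congʳ den-a ⟩
      u * p * d * e′ * i
        ≈⟨ solve 5 (λ u p d e i → u :* p :* d :* e :* i := u :* p :* d :* i :* e) refl u p d e′ i ⟩
      u * p * d * i * e′     ∎

    -- The summand `p` is a block completed within the current run; the other one is a block that
    -- needs a later run.
    block-run : e ≈ (p + u * p * q * i) * e′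
    block-run = begin
      e                                    ≈⟨ e≈ ⟩
      a * s + p * e′                       ≈⟨ +-congʳ (*-congʳ block-new) ⟩
      u * p * d * i * e′ * s + p * e′
        ≈⟨ solve 6 (λ u p d i e s → u :* p :* d :* i :* e :* s :+ p :* e := (p :+ u :* p :* (s :* d) :* i) :* e) refl u p d i e′ s ⟩
      (p + u * p * (s * d) * i) * e′       ≈⟨ *-congʳ (+-congˡ (*-congʳ (*-congˡ sd≈q))) ⟩
      (p + u * p * q * i) * e′             ∎

  -- When every block is matched the state no longer changes, so both equations refer back to `e`
  -- and force it to be `1/(1 - x - u x)`.
  final-run : ∀ {x u d den i a e} → d + x ≈ 1# → den + u * x ≈ d → den * i ≈ 1# →
              e ≈ a + x * e → a ≈ 1# + u * (x * e) → e ≈ i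
  final-run {x} {u} {d} {den} {i} {a} {e} dx den-split den-inv e≈ a≈ = inverse-unique den-inv
    (+-cancelʳ (u * (x * e) + x * e) _ _ (begin
      den * e + (u * (x * e) + x * e)
        ≈⟨ solve 4 (λ den e u x → den :* e :+ (u :* (x :* e) :+ x :* e) := (den :+ u :* x :+ x) :* e) refl den e u x ⟩
      (den + u * x + x) * e               ≈⟨ *-congʳ (trans (+-congʳ den-split) dx) ⟩
      1# * e                              ≈⟨ *-identityˡ e ⟩
      e                                   ≈⟨ e≈ ⟩
      a + x * e                           ≈⟨ +-congʳ a≈ ⟩
      1# + u * (x * e) + x * e            ≈⟨ +-assoc _ _ _ ⟩
      1# + (u * (x * e) + x * e)          ∎))

open import Data.Rational using (ℚ; toℚᵘ; 0ℚ; 1ℚ; _/_; _+_; _*_; _-_; -_)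
open import Data.Rational.Properties as ℚₚ
  using (+-*-commutativeRing; toℚᵘ-injective; toℚᵘ-fromℚᵘ; toℚᵘ-homo-+; toℚᵘ-homo-*)
open import Data.Rational.Solver using (module +-*-Solver)
open +-*-Solver using (solve; _:=_; _:+_; _:*_; :-_)
open import Relation.Binary.PropositionalEquality

-- Polynomials in t and the functional Φ

Φfrom : ℕ → Poly → ℚ
Φfrom n []      = 0ℚ
Φfrom n (a ∷ q) = a * ℕtoℚ (n !) + Φfrom (suc n) q

-- The local function of Φ cannot be named here.  Its occurrence in the goal of Φ-tail has only
-- variables as arguments after the with-abstraction, which lets Agda infer the type of Φ-go.
mutual
  Φ≡Φfrom : ∀ p → Φ p ≡ Φfrom 0 p
  Φ≡Φfrom [] = refl
  Φ≡Φfrom (a ∷ q) = cong (a * 1ℚ +_) (Φ-tail a q)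

  Φ-tail : ∀ a q → _ ≡ Φfrom 1 q
  Φ-tail a q with a ∷ q | 1
  ... | w | n = Φ-go w n q

  Φ-go : ∀ p n q → _ ≡ Φfrom n q
  Φ-go p n [] = refl
  Φ-go p n (a ∷ q) = cong (a * ℕtoℚ (n !) +_) (Φ-go p (suc n) q)

lpolyUpTo : ℕ → ℕ → Poly
lpolyUpTo k zero    = monomial 0 ((yOver1py 1^ 0) k)
lpolyUpTo k (suc j) = lpolyUpTo k j p+ monomial (suc j) (invFact (suc j) * (yOver1py 1^ suc j) k)

lcoef : ℕ → ℕ → ℚ
lcoef w k = invFact (suc k) * (yOver1py 1^ suc k) w

-- As for Φ; abstracting the top coefficient first frees the statement of lpoly-go from suc k.
mutual
  lpoly≡ : ∀ k → lpoly k ≡ lpolyUpTo k k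
  lpoly≡ zero = refl
  lpoly≡ (suc k) with invFact (suc k) * (yOver1py 1^ suc k) (suc k)
  ... | c with suc k
  ... | w = lpoly-go w k c

  lpoly-go : ∀ w k (c : ℚ) → _
  lpoly-go w zero c = refl
  lpoly-go w (suc k) c = cong (_p+ (monomial (suc (suc k)) c)) (lpoly-go w k (lcoef w k))

-- Natural numbers inside the rationals

module _ where
  open ℚᵘₚ.≃-Reasoning

  ι : ℕ → ℚᵘ.ℚᵘ
  ι k = ℚᵘ.mkℚᵘ (ℤ.+ k) 0

  ℕtoℚ-homo-+ : ∀ m n → ℕtoℚ (m ℕ.+ n) ≡ ℕtoℚ m + ℕtoℚ n
  ℕtoℚ-homo-+ m n = toℚᵘ-injective (begin
    toℚᵘ (ℕtoℚ (m ℕ.+ n))                        ≈⟨ toℚᵘ-fromℚᵘ (ι (m ℕ.+ n)) ⟩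
    ι (m ℕ.+ n)
      ≈⟨ ℚᵘ.*≡* (cong (λ z → z ℤ.* ℤ.1ℤ) (sym (cong₂ ℤ._+_ (ℤₚ.*-identityʳ (ℤ.+ m)) (ℤₚ.*-identityʳ (ℤ.+ n))))) ⟩
    ι m ℚᵘ.+ ι n                                 ≈⟨ ℚᵘₚ.+-cong (toℚᵘ-fromℚᵘ (ι m)) (toℚᵘ-fromℚᵘ (ι n)) ⟨
    toℚᵘ (ℕtoℚ m) ℚᵘ.+ toℚᵘ (ℕtoℚ n)             ≈⟨ toℚᵘ-homo-+ (ℕtoℚ m) (ℕtoℚ n) ⟨
    toℚᵘ (ℕtoℚ m + ℕtoℚ n)                       ∎)

  ℕtoℚ-homo-* : ∀ m n → ℕtoℚ (m ℕ.* n) ≡ ℕtoℚ m * ℕtoℚ n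
  ℕtoℚ-homo-* m n = toℚᵘ-injective (begin
    toℚᵘ (ℕtoℚ (m ℕ.* n))                        ≈⟨ toℚᵘ-fromℚᵘ (ι (m ℕ.* n)) ⟩
    ι (m ℕ.* n)                                  ≈⟨ ℚᵘ.*≡* (cong (λ z → z ℤ.* ℤ.1ℤ) (ℤₚ.pos-* m n)) ⟩
    ι m ℚᵘ.* ι n                                 ≈⟨ ℚᵘₚ.*-cong (toℚᵘ-fromℚᵘ (ι m)) (toℚᵘ-fromℚᵘ (ι n)) ⟨
    toℚᵘ (ℕtoℚ m) ℚᵘ.* toℚᵘ (ℕtoℚ n)             ≈⟨ toℚᵘ-homo-* (ℕtoℚ m) (ℕtoℚ n) ⟨
    toℚᵘ (ℕtoℚ m * ℕtoℚ n)                       ∎)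

  recip : (d : ℕ) .{{_ : NonZero d}} → (ℤ.+ 1 / d) * ℕtoℚ d ≡ 1ℚ
  recip (suc d) = toℚᵘ-injective (begin
    toℚᵘ ((ℤ.+ 1 / suc d) * ℕtoℚ (suc d))           ≈⟨ toℚᵘ-homo-* (ℤ.+ 1 / suc d) (ℕtoℚ (suc d)) ⟩
    toℚᵘ (ℤ.+ 1 / suc d) ℚᵘ.* toℚᵘ (ℕtoℚ (suc d))
      ≈⟨ ℚᵘₚ.*-cong (toℚᵘ-fromℚᵘ (ℚᵘ.mkℚᵘ (ℤ.+ 1) d)) (toℚᵘ-fromℚᵘ (ℚᵘ.mkℚᵘ (ℤ.+ suc d) 0)) ⟩
    ℚᵘ.mkℚᵘ (ℤ.+ 1) d ℚᵘ.* ℚᵘ.mkℚᵘ (ℤ.+ suc d) 0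
      ≈⟨ ℚᵘ.*≡* (cong ℤ.+_ (trans (ℕₚ.*-identityʳ (suc d ℕ.+ 0)) (trans (ℕₚ.+-identityʳ (suc d)) (sym (trans (ℕₚ.+-identityʳ (suc d ℕ.* 1)) (ℕₚ.*-identityʳ (suc d))))))) ⟩
    ℚᵘ.1ℚᵘ                                          ∎)

open ≡-Reasoning

invFact-suc : ∀ n → ℕtoℚ (suc n) * invFact (suc n) ≡ invFact n
invFact-suc n = begin
  ℕtoℚ (suc n) * invFact (suc n)
    ≡⟨ ℚₚ.*-identityʳ _ ⟨
  ℕtoℚ (suc n) * invFact (suc n) * 1ℚ
    ≡⟨ cong (ℕtoℚ (suc n) * invFact (suc n) *_) (recip (n !) {{n !≢0}}) ⟨
  ℕtoℚ (suc n) * invFact (suc n) * (invFact n * ℕtoℚ (n !))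
    ≡⟨ solve 4 (λ a b c d → a :* b :* (c :* d) := b :* (a :* d) :* c) refl (ℕtoℚ (suc n)) (invFact (suc n)) (invFact n) (ℕtoℚ (n !)) ⟩
  invFact (suc n) * (ℕtoℚ (suc n) * ℕtoℚ (n !)) * invFact n
    ≡⟨ cong (λ z → invFact (suc n) * z * invFact n) (ℕtoℚ-homo-* (suc n) (n !)) ⟨
  invFact (suc n) * ℕtoℚ (suc n !) * invFact n
    ≡⟨ cong (_* invFact n) (recip (suc n !) {{suc n !≢0}}) ⟩
  1ℚ * invFact n
    ≡⟨ ℚₚ.*-identityˡ _ ⟩
  invFact n ∎

-- The rings of series and polynomials

module 𝕊 = PowerSeries +-*-commutativeRing
-- The outer index is the exponent of x, the inner one that of u. Since the coefficients are
-- univariate series, `𝕊².pow`, `𝕊².sum≤` and `𝕊².geometric` operate on univariate series.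
module 𝕊² = PowerSeries 𝕊.seriesRing
open 𝕊 using (_⊛_; ⊛-cong; ⊛-comm; ⊛-assoc; ⊛-zeroˡ; ⊛-identityˡ; ⊛-sum≤; ⊛-order; ⊛-local;
  tail; 𝟙; y; y⊛-zero; y⊛-suc; sum≤; sum≤-cong)

coef : Poly → Ser1
coef []      n       = 0ℚ
coef (a ∷ p) zero    = a
coef (a ∷ p) (suc n) = coef p n

infix 4 _≋_
-- Equality of lists would distinguish trailing zeros. The record wrapper allows `p` and `q` to be
-- inferred from a proof, which a bare family of equations would not.
record _≋_ (p q : Poly) : Set where
  constructor coeffwise
  field coef-≡ : ∀ n → coef p n ≡ coef q n
open _≋_ public

coef-+ : ∀ p q n → coef (p p+ q) n ≡ coef p n + coef q n
coef-+ []      q       n       = sym (ℚₚ.+-identityˡ _)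
coef-+ (a ∷ p) []      n       = sym (ℚₚ.+-identityʳ _)
coef-+ (a ∷ p) (b ∷ q) zero    = refl
coef-+ (a ∷ p) (b ∷ q) (suc n) = coef-+ p q n

coef-scale : ∀ c p n → coef (pscale c p) n ≡ c * coef p n
coef-scale c []      n       = sym (ℚₚ.*-zeroʳ c)
coef-scale c (a ∷ p) zero    = refl
coef-scale c (a ∷ p) (suc n) = coef-scale c p n

coef-neg : ∀ p n → coef (p- p) n ≡ - coef p n
coef-neg []      n       = refl
coef-neg (a ∷ p) zero    = refl
coef-neg (a ∷ p) (suc n) = coef-neg p n

coef-* : ∀ p q n → coef (p p* q) n ≡ (coef p ⊛ coef q) n
coef-* []      q n       = sym (⊛-zeroˡ (coef q) n)
coef-* (a ∷ p) q zero    = begin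
  coef (pscale a q p+ (0ℚ ∷ (p p* q))) 0       ≡⟨ coef-+ (pscale a q) (0ℚ ∷ (p p* q)) 0 ⟩
  coef (pscale a q) 0 + 0ℚ                     ≡⟨ ℚₚ.+-identityʳ _ ⟩
  coef (pscale a q) 0                          ≡⟨ coef-scale a q 0 ⟩
  a * coef q 0                                 ∎
coef-* (a ∷ p) q (suc n) = begin
  coef (pscale a q p+ (0ℚ ∷ (p p* q))) (suc n) ≡⟨ coef-+ (pscale a q) (0ℚ ∷ (p p* q)) (suc n) ⟩
  coef (pscale a q) (suc n) + coef (p p* q) n  ≡⟨ cong₂ _+_ (coef-scale a q (suc n)) (coef-* p q n) ⟩
  a * coef q (suc n) + (coef p ⊛ coef q) n     ∎

coef-monomial-≡ : ∀ n c → coef (monomial n c) n ≡ c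
coef-monomial-≡ zero    c = refl
coef-monomial-≡ (suc n) c = coef-monomial-≡ n c

coef-monomial-≢ : ∀ m n c → m ≢ n → coef (monomial m c) n ≡ 0ℚ
coef-monomial-≢ zero    zero    c ne with () ← ne refl
coef-monomial-≢ zero    (suc n) c ne = refl
coef-monomial-≢ (suc m) zero    c ne = refl
coef-monomial-≢ (suc m) (suc n) c ne = coef-monomial-≢ m n c (λ e → ne (cong suc e))

-- Polynomials and `Ser2` keep their given operations and inherit the ring laws of series along an
-- injective homomorphism.
commutativeRingVia : ∀ {a ℓ₁ b ℓ₂} {R : RawRing a ℓ₁} (S : CommutativeRing b ℓ₂) {f} →
  IsRingMonomorphism R (CommutativeRing.rawRing S) f → CommutativeRing a ℓ₁
commutativeRingVia S mono = record
  { isCommutativeRing = RingMono.isCommutativeRing mono (CommutativeRing.isCommutativeRing S) }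

polyRing : CommutativeRing _ _
polyRing = commutativeRingVia
  {R = record { Carrier = Poly ; _≈_ = _≋_ ; _+_ = _p+_ ; _*_ = _p*_ ; -_ = p- ; 0# = [] ; 1# = 1ℚ ∷ [] }}
  𝕊.seriesRing {coef} record
  { isRingHomomorphism = record
    { isSemiringHomomorphism = record
      { isNearSemiringHomomorphism = record
        { +-isMonoidHomomorphism = record
          { isMagmaHomomorphism = record
            { isRelHomomorphism = record { cong = coef-≡ }
            ; homo = coef-+ }
          ; ε-homo = λ _ → refl }
        ; *-homo = coef-* }
      ; 1#-homo = λ { zero → refl ; (suc _) → refl } }
    ; -‿homo = coef-neg }
  ; injective = coeffwise }

module ℙ = CommutativeRing polyRing
open ℙ using () renaming (_+_ to infixl 6 _⊞_; _*_ to infixl 7 _⊠_)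

-- The derivative in t and integration by parts

Dfrom : ℕ → Poly → Poly
Dfrom n []      = []
Dfrom n (a ∷ p) = (ℕtoℚ n * a) ∷ Dfrom (suc n) p

D : Poly → Poly
D []      = []
D (a ∷ p) = Dfrom 1 p

coef-Dfrom : ∀ m p n → coef (Dfrom m p) n ≡ ℕtoℚ (m ℕ.+ n) * coef p n
coef-Dfrom m []      n       = sym (ℚₚ.*-zeroʳ (ℕtoℚ (m ℕ.+ n)))
coef-Dfrom m (a ∷ p) zero    = cong (λ z → ℕtoℚ z * a) (sym (ℕₚ.+-identityʳ m))
coef-Dfrom m (a ∷ p) (suc n) = trans (coef-Dfrom (suc m) p n) (cong (λ z → ℕtoℚ z * coef p n) (sym (ℕₚ.+-suc m n)))

coef-D : ∀ p n → coef (D p) n ≡ ℕtoℚ (suc n) * coef p (suc n)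
coef-D []      n = sym (ℚₚ.*-zeroʳ (ℕtoℚ (suc n)))
coef-D (a ∷ p) n = coef-Dfrom 1 p n

D-+ : ∀ p q → D (p p+ q) ≋ (D p) p+ (D q)
D-+ p q = coeffwise λ n → begin
  coef (D (p p+ q)) n                                                       ≡⟨ coef-D (p p+ q) n ⟩
  ℕtoℚ (suc n) * coef (p p+ q) (suc n)
    ≡⟨ cong (ℕtoℚ (suc n) *_) (coef-+ p q (suc n)) ⟩
  ℕtoℚ (suc n) * (coef p (suc n) + coef q (suc n))
    ≡⟨ ℚₚ.*-distribˡ-+ (ℕtoℚ (suc n)) _ _ ⟩
  ℕtoℚ (suc n) * coef p (suc n) + ℕtoℚ (suc n) * coef q (suc n)
    ≡⟨ cong₂ _+_ (coef-D p n) (coef-D q n) ⟨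
  coef (D p) n + coef (D q) n                                               ≡⟨ coef-+ (D p) (D q) n ⟨
  coef ((D p) p+ (D q)) n                                                       ∎

D-scale : ∀ c p → D (pscale c p) ≋ pscale c (D p)
D-scale c p = coeffwise λ n → begin
  coef (D (pscale c p)) n                     ≡⟨ coef-D (pscale c p) n ⟩
  ℕtoℚ (suc n) * coef (pscale c p) (suc n)    ≡⟨ cong (ℕtoℚ (suc n) *_) (coef-scale c p (suc n)) ⟩
  ℕtoℚ (suc n) * (c * coef p (suc n))
    ≡⟨ solve 3 (λ x y z → x :* (y :* z) := y :* (x :* z)) refl (ℕtoℚ (suc n)) c (coef p (suc n)) ⟩
  c * (ℕtoℚ (suc n) * coef p (suc n))         ≡⟨ cong (c *_) (coef-D p n) ⟨
  c * coef (D p) n                            ≡⟨ coef-scale c (D p) n ⟨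
  coef (pscale c (D p)) n                     ∎

D-∷ : ∀ a p → D (a ∷ p) ≋ p p+ (0ℚ ∷ D p)
D-∷ a p = coeffwise λ n → trans (coef-Dfrom 1 p n) (trans (go n) (sym (coef-+ p (0ℚ ∷ D p) n)))
  where
  go : ∀ n → ℕtoℚ (suc n) * coef p n ≡ coef p n + coef (0ℚ ∷ D p) n
  go zero    = trans (ℚₚ.*-identityˡ (coef p 0)) (sym (ℚₚ.+-identityʳ (coef p 0)))
  go (suc n) = begin
    ℕtoℚ (1 ℕ.+ suc n) * coef p (suc n)                  ≡⟨ cong (_* coef p (suc n)) (ℕtoℚ-homo-+ 1 (suc n)) ⟩
    (1ℚ + ℕtoℚ (suc n)) * coef p (suc n)
      ≡⟨ ℚₚ.*-distribʳ-+ (coef p (suc n)) 1ℚ (ℕtoℚ (suc n)) ⟩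
    1ℚ * coef p (suc n) + ℕtoℚ (suc n) * coef p (suc n)
      ≡⟨ cong₂ _+_ (ℚₚ.*-identityˡ (coef p (suc n))) (sym (coef-D p n)) ⟩
    coef p (suc n) + coef (D p) n                        ∎

∷-cong : ∀ {a b p q} → a ≡ b → p ≋ q → (a ∷ p) ≋ (b ∷ q)
∷-cong e e′ = coeffwise λ { zero → e ; (suc n) → coef-≡ e′ n }

scale-cong : ∀ {c d p q} → c ≡ d → p ≋ q → pscale c p ≋ pscale d q
scale-cong {c} {_} {p} {q} refl e = coeffwise λ n →
  trans (coef-scale c p n) (trans (cong (c *_) (coef-≡ e n)) (sym (coef-scale c q n)))

shift-* : ∀ p q → (0ℚ ∷ p) p* q ≋ (0ℚ ∷ (p p* q))
shift-* p q = coeffwise λ n → begin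
  coef (pscale 0ℚ q p+ (0ℚ ∷ (p p* q))) n           ≡⟨ coef-+ (pscale 0ℚ q) (0ℚ ∷ (p p* q)) n ⟩
  coef (pscale 0ℚ q) n + coef (0ℚ ∷ (p p* q)) n
    ≡⟨ cong (_+ coef (0ℚ ∷ (p p* q)) n) (trans (coef-scale 0ℚ q n) (ℚₚ.*-zeroˡ (coef q n))) ⟩
  0ℚ + coef (0ℚ ∷ (p p* q)) n                       ≡⟨ ℚₚ.+-identityˡ _ ⟩
  coef (0ℚ ∷ (p p* q)) n                            ∎

shift-+ : ∀ p q → (0ℚ ∷ (p p+ q)) ≋ (0ℚ ∷ p) p+ (0ℚ ∷ q)
shift-+ p q = coeffwise λ { zero → sym (ℚₚ.+-identityˡ 0ℚ) ; (suc n) → refl }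

-- Induction on the first factor in the form `a + t p`, whose derivative is `p + t p'` by `D-∷`.
D-* : ∀ p q → D (p ⊠ q) ≋ D p ⊠ q ⊞ p ⊠ D q
D-* []      q = coeffwise λ n → refl
D-* (a ∷ p) q = ℙ.trans lhs (ℙ.trans (rearrange (pscale a (D q)) (p ⊠ q) (0ℚ ∷ (D p ⊠ q)) (0ℚ ∷ (p ⊠ D q))) (ℙ.sym rhs))
  where
  rearrange : ∀ s u v w → s ⊞ (u ⊞ (v ⊞ w)) ≋ (u ⊞ v) ⊞ (s ⊞ w)
  rearrange s u v w = coeffwise λ n →
    trans (coef-+₃ s u v w n) (trans (solve 4 (λ s u v w → s :+ (u :+ (v :+ w)) := (u :+ v) :+ (s :+ w)) refl
        (coef s n) (coef u n) (coef v n) (coef w n))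
      (sym (trans (coef-+ (u ⊞ v) (s ⊞ w) n) (cong₂ _+_ (coef-+ u v n) (coef-+ s w n)))))
    where
    coef-+₃ : ∀ s u v w n → coef (s ⊞ (u ⊞ (v ⊞ w))) n ≡ coef s n + (coef u n + (coef v n + coef w n))
    coef-+₃ s u v w n = trans (coef-+ s (u ⊞ (v ⊞ w)) n) (cong (coef s n +_)
      (trans (coef-+ u (v ⊞ w) n) (cong (coef u n +_) (coef-+ v w n))))
  lhs : D ((a ∷ p) ⊠ q) ≋ pscale a (D q) ⊞ (p ⊠ q ⊞ ((0ℚ ∷ (D p ⊠ q)) ⊞ (0ℚ ∷ (p ⊠ D q))))
  lhs = ℙ.trans (D-+ (pscale a q) (0ℚ ∷ (p ⊠ q))) (ℙ.+-cong (D-scale a q) (ℙ.trans (D-∷ 0ℚ (p ⊠ q))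
    (ℙ.+-cong (ℙ.refl {p ⊠ q}) (ℙ.trans (∷-cong refl (D-* p q)) (shift-+ (D p ⊠ q) (p ⊠ D q))))))
  rhs : D (a ∷ p) ⊠ q ⊞ (a ∷ p) ⊠ D q ≋ (p ⊠ q ⊞ (0ℚ ∷ (D p ⊠ q))) ⊞ (pscale a (D q) ⊞ (0ℚ ∷ (p ⊠ D q)))
  rhs = ℙ.+-cong (ℙ.trans (ℙ.*-cong (D-∷ a p) (ℙ.refl {q})) (ℙ.trans (ℙ.distribʳ q p (0ℚ ∷ D p))
    (ℙ.+-cong (ℙ.refl {p ⊠ q}) (shift-* (D p) q)))) (ℙ.refl {pscale a (D q) ⊞ (0ℚ ∷ (p ⊠ D q))})

Φfrom-zero : ∀ n p → (∀ i → coef p i ≡ 0ℚ) → Φfrom n p ≡ 0ℚ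
Φfrom-zero n []      e = refl
Φfrom-zero n (a ∷ p) e = trans
  (cong₂ _+_ (trans (cong (_* ℕtoℚ (n !)) (e 0)) (ℚₚ.*-zeroˡ (ℕtoℚ (n !)))) (Φfrom-zero (suc n) p (λ i → e (suc i)))) (ℚₚ.+-identityˡ 0ℚ)

Φfrom-+ : ∀ n p q → Φfrom n (p p+ q) ≡ Φfrom n p + Φfrom n q
Φfrom-+ n []      q       = sym (ℚₚ.+-identityˡ _)
Φfrom-+ n (a ∷ p) []      = sym (ℚₚ.+-identityʳ _)
Φfrom-+ n (a ∷ p) (b ∷ q) = trans (cong ((a + b) * ℕtoℚ (n !) +_) (Φfrom-+ (suc n) p q))
  (solve 5 (λ a b c x y → (a :+ b) :* c :+ (x :+ y) := (a :* c :+ x) :+ (b :* c :+ y)) refl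
    a b (ℕtoℚ (n !)) (Φfrom (suc n) p) (Φfrom (suc n) q))

Φfrom-neg : ∀ n p → Φfrom n (p- p) ≡ - Φfrom n p
Φfrom-neg n []      = refl
Φfrom-neg n (a ∷ p) = trans (cong (- a * ℕtoℚ (n !) +_) (Φfrom-neg (suc n) p))
  (solve 3 (λ a c x → (:- a) :* c :+ (:- x) := :- (a :* c :+ x)) refl a (ℕtoℚ (n !)) (Φfrom (suc n) p))

Φ-+ : ∀ p q → Φ (p p+ q) ≡ Φ p + Φ q
Φ-+ p q = trans (Φ≡Φfrom (p p+ q)) (trans (Φfrom-+ 0 p q) (sym (cong₂ _+_ (Φ≡Φfrom p) (Φ≡Φfrom q))))

Φ-neg : ∀ p → Φ (p- p) ≡ - Φ p
Φ-neg p = trans (Φ≡Φfrom (p- p)) (trans (Φfrom-neg 0 p) (cong -_ (sym (Φ≡Φfrom p))))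

-- `Φ` is computed on lists, so invariance under trailing zeros needs an argument: additivity
-- reduces it to `Φ (p - q) = 0`, where all coefficients vanish.
Φ-cong : ∀ {p q} → p ≋ q → Φ p ≡ Φ q
Φ-cong {p} {q} e = begin
  Φ p                       ≡⟨ solve 2 (λ a b → a := a :+ (:- b) :+ b) refl (Φ p) (Φ q) ⟩
  Φ p + - Φ q + Φ q         ≡⟨ cong (λ z → Φ p + z + Φ q) (Φ-neg q) ⟨
  Φ p + Φ (p- q) + Φ q      ≡⟨ cong (_+ Φ q) (Φ-+ p (p- q)) ⟨
  Φ (p p+ (p- q)) + Φ q
    ≡⟨ cong (_+ Φ q) (trans (Φ≡Φfrom (p p+ (p- q))) (Φfrom-zero 0 (p p+ (p- q)) (coef-≡ p-q≋0))) ⟩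
  0ℚ + Φ q                  ≡⟨ ℚₚ.+-identityˡ _ ⟩
  Φ q                       ∎
  where
  p-q≋0 : p p+ (p- q) ≋ []
  p-q≋0 = ℙ.trans (ℙ.+-cong e (ℙ.refl {p- q})) (ℙ.-‿inverseʳ q)

Φfrom-Dfrom : ∀ n p → Φfrom n (Dfrom (suc n) p) ≡ Φfrom (suc n) p
Φfrom-Dfrom n []      = refl
Φfrom-Dfrom n (a ∷ p) = cong₂ _+_
  (trans (solve 3 (λ x a y → x :* a :* y := a :* (x :* y)) refl (ℕtoℚ (suc n)) a (ℕtoℚ (n !)))
    (cong (a *_) (sym (ℕtoℚ-homo-* (suc n) (n !)))))
  (Φfrom-Dfrom (suc n) p)

-- Integration by parts against e^{-t}: Φ p = ∫₀^∞ p(t) e^{-t} dt.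
Φ-by-parts : ∀ p → Φ p ≡ coef p 0 + Φ (D p)
Φ-by-parts []      = refl
Φ-by-parts (a ∷ p) = trans (Φ≡Φfrom (a ∷ p)) (cong₂ _+_ (ℚₚ.*-identityʳ a)
  (sym (trans (Φ≡Φfrom (Dfrom 1 p)) (Φfrom-Dfrom 0 p))))

-- The polynomials l_k

sumTo-sum≤ : ∀ n f → sumTo n f ≡ sum≤ n f
sumTo-sum≤ zero    f = refl
sumTo-sum≤ (suc n) f = cong (_+ f (suc n)) (sumTo-sum≤ n f)

1*-⊛ : ∀ f g n → (f 1* g) n ≡ (f ⊛ g) n
1*-⊛ f g n = trans (sumTo-sum≤ n (λ i → f i * g (n ∸ i))) (⊛-sum≤ n f g)

1^-pow : ∀ {f g} → (∀ n → f n ≡ g n) → ∀ j n → (f 1^ j) n ≡ 𝕊².pow g j n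
1^-pow e zero    zero    = refl
1^-pow e zero    (suc n) = refl
1^-pow {f} {g} e (suc j) n = trans (1*-⊛ f (f 1^ j) n) (⊛-cong {f} {g} {f 1^ j} {𝕊².pow g j} e (1^-pow e j) n)

pow-order : ∀ {h} → h 0 ≡ 0ℚ → ∀ j n → n ℕ.< j → 𝕊².pow h j n ≡ 0ℚ
pow-order e zero    n ()
pow-order {h} e (suc j) n lt = ⊛-order {h} {𝕊².pow h j} j e (pow-order e j) n lt

sum≤-pointwise : ∀ m (F : ℕ → Ser1) n → 𝕊².sum≤ m F n ≡ sum≤ m (λ j → F j n)
sum≤-pointwise zero    F n = refl
sum≤-pointwise (suc m) F n = cong (_+ F (suc m) n) (sum≤-pointwise m F n)

sum≤-extend : ∀ d m f → (∀ j → m ℕ.< j → f j ≡ 0ℚ) → sum≤ (d ℕ.+ m) f ≡ sum≤ m f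
sum≤-extend zero    m f v = refl
sum≤-extend (suc d) m f v = trans (cong₂ _+_ (sum≤-extend d m f v) (v (suc d ℕ.+ m) (s≤s (ℕₚ.m≤n+m m d)))) (ℚₚ.+-identityʳ _)

sum≤-extend′ : ∀ {m n} f → m ℕ.≤ n → (∀ j → m ℕ.< j → f j ≡ 0ℚ) → sum≤ n f ≡ sum≤ m f
sum≤-extend′ {m} {n} f m≤n v = trans (cong (λ k → sum≤ k f) (sym (ℕₚ.m∸n+n≡m m≤n))) (sum≤-extend (n ∸ m) m f v)

module _ (f : Ser1) (f0 : f 0 ≡ 1ℚ) where
  private
    h : Ser1
    h = 𝟙 𝕊.⊕ (𝕊.⊖ f)
    h0 : h 0 ≡ 0ℚ
    h0 = cong (λ z → 1ℚ - z) f0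
    f+h : ∀ n → (f 𝕊.⊕ h) n ≡ 𝟙 n
    f+h n = solve 2 (λ a b → a :+ (b :+ (:- a)) := b) refl (f n) (𝟙 n)

  inv1-pow : ∀ n → inv1 f n ≡ sum≤ n (λ j → 𝕊².pow h j n)
  inv1-pow n = trans (sumTo-sum≤ n _) (sum≤-cong n (λ j →
    1^-pow {g = h} (λ { zero → refl ; (suc i) → sym (ℚₚ.+-identityˡ (- f (suc i))) }) j n))

  -- Each coefficient of `inv1 f` is truncated at its own index. As `h^j` starts in degree `j`, all
  -- of them up to `n` may be truncated at `n`, and the remainder `h^(n+1)` of the telescoping sum
  -- is invisible at `n`.
  inv1-inverseʳ : ∀ n → (f ⊛ inv1 f) n ≡ 𝟙 n
  inv1-inverseʳ n = begin
    (f ⊛ inv1 f) n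
      ≡⟨ ⊛-local n {f} {f} {inv1 f} {𝕊².sum≤ n (𝕊².pow h)} (λ _ _ → refl) (λ i i≤n → trans (inv1-pow i)
           (trans (sym (sum≤-extend′ (λ j → 𝕊².pow h j i) i≤n (λ j → pow-order {h} h0 j i))) (sym (sum≤-pointwise n (𝕊².pow h) i)))) ⟩
    (f ⊛ 𝕊².sum≤ n (𝕊².pow h)) n
      ≡⟨ ℚₚ.+-identityʳ _ ⟨
    (f ⊛ 𝕊².sum≤ n (𝕊².pow h)) n + 0ℚ
      ≡⟨ cong ((f ⊛ 𝕊².sum≤ n (𝕊².pow h)) n +_) (pow-order {h} h0 (suc n) n ℕₚ.≤-refl) ⟨
    (f ⊛ 𝕊².sum≤ n (𝕊².pow h)) n + 𝕊².pow h (suc n) n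
      ≡⟨ 𝕊².geometric f h f+h n n ⟩
    𝟙 n ∎

Y : Ser1
Y = yOver1py

one+y : Ser1
one+y 0 = 1ℚ
one+y 1 = 1ℚ
one+y _ = 0ℚ

one+y-⊛ : ∀ f n → (one+y ⊛ f) (suc n) ≡ f (suc n) + f n
one+y-⊛ f n = cong₂ _+_ (ℚₚ.*-identityˡ (f (suc n)))
  (trans (⊛-cong {tail one+y} {𝟙} {f} {f} (λ { zero → refl ; (suc n) → refl }) (λ _ → refl) n) (⊛-identityˡ f n))

sumTo-cong : ∀ n {f g} → (∀ i → f i ≡ g i) → sumTo n f ≡ sumTo n g
sumTo-cong zero    e = e 0
sumTo-cong (suc n) e = cong₂ _+_ (sumTo-cong n e) (e (suc n))

1^-cong : ∀ {f g} → (∀ n → f n ≡ g n) → ∀ j n → (f 1^ j) n ≡ (g 1^ j) n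
1^-cong {f} {g} e j n = trans (1^-pow {f} {g} e j n) (sym (1^-pow {g} {g} (λ _ → refl) j n))

inv1-cong : ∀ {f g} → (∀ n → f n ≡ g n) → ∀ n → inv1 f n ≡ inv1 g n
inv1-cong e n = sumTo-cong n (λ j → 1^-cong
  (λ { zero → cong (λ z → 1ℚ - z) (e 0) ; (suc i) → cong -_ (e (suc i)) }) j n)

Y-quotient : ∀ n → Y n ≡ (y ⊛ inv1 one+y) n
Y-quotient n = trans (sumTo-cong n (λ
    { 0             → cong (0ℚ *_) (inv1-cong one+y≐ (n ∸ 0))
    ; 1             → cong (1ℚ *_) (inv1-cong one+y≐ (n ∸ 1))
    ; (suc (suc i)) → cong (0ℚ *_) (inv1-cong one+y≐ (n ∸ suc (suc i))) }))
  (1*-⊛ y (inv1 one+y) n)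
  where
  -- The underscore stands for the anonymous function inside `yOver1py`, which cannot be written a
  -- second time: two pattern-matching lambdas are never the same function to Agda.
  one+y≐ : ∀ n → _ ≡ one+y n
  one+y≐ = λ { 0 → refl ; 1 → refl ; (suc (suc n)) → refl }

one+y-⊛-Y : ∀ n → (one+y ⊛ Y) n ≡ y n
one+y-⊛-Y n = begin
  (one+y ⊛ Y) n                     ≡⟨ ⊛-cong {one+y} {one+y} {Y} {y ⊛ i} (λ _ → refl) Y-quotient n ⟩
  (one+y ⊛ (y ⊛ i)) n               ≡⟨ ⊛-assoc one+y y i n ⟨
  ((one+y ⊛ y) ⊛ i) n
    ≡⟨ ⊛-cong {one+y ⊛ y} {y ⊛ one+y} {i} {i} (⊛-comm one+y y) (λ _ → refl) n ⟩
  ((y ⊛ one+y) ⊛ i) n               ≡⟨ ⊛-assoc y one+y i n ⟩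
  (y ⊛ (one+y ⊛ i)) n
    ≡⟨ ⊛-cong {y} {y} {one+y ⊛ i} {𝟙} (λ _ → refl) (inv1-inverseʳ one+y refl) n ⟩
  (y ⊛ 𝟙) n                         ≡⟨ trans (⊛-comm y 𝟙 n) (⊛-identityˡ y n) ⟩
  y n                               ∎
  where
  i : Ser1
  i = inv1 one+y

Y0 : Y 0 ≡ 0ℚ
Y0 = refl

-- Multiplication of `Y^(j+1)` by `1 + y`, using `(1 + y) Y = y`.
Y^-recurrence : ∀ j n → (Y 1^ suc j) (suc n) + (Y 1^ suc j) n ≡ (Y 1^ j) n
Y^-recurrence j n = begin
  (Y 1^ suc j) (suc n) + (Y 1^ suc j) n        ≡⟨ one+y-⊛ (Y 1^ suc j) n ⟨
  (one+y ⊛ (Y 1^ suc j)) (suc n)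
    ≡⟨ ⊛-cong {one+y} {one+y} {Y 1^ suc j} {Y ⊛ (Y 1^ j)} (λ _ → refl) (1*-⊛ Y (Y 1^ j)) (suc n) ⟩
  (one+y ⊛ (Y ⊛ (Y 1^ j))) (suc n)             ≡⟨ ⊛-assoc one+y Y (Y 1^ j) (suc n) ⟨
  ((one+y ⊛ Y) ⊛ (Y 1^ j)) (suc n)
    ≡⟨ ⊛-cong {one+y ⊛ Y} {y} {Y 1^ j} {Y 1^ j} one+y-⊛-Y (λ _ → refl) (suc n) ⟩
  (y ⊛ (Y 1^ j)) (suc n)                       ≡⟨ y⊛-suc (Y 1^ j) n ⟩
  (Y 1^ j) n                                   ∎

Y^-order : ∀ j n → n ℕ.< j → (Y 1^ j) n ≡ 0ℚ
Y^-order j n lt = trans (1^-pow {Y} (λ _ → refl) j n) (pow-order {Y} Y0 j n lt)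

coef-lpolyUpTo-≤ : ∀ k m j → j ℕ.≤ m → coef (lpolyUpTo k m) j ≡ invFact j * (Y 1^ j) k
coef-lpolyUpTo-> : ∀ k m j → m ℕ.< j → coef (lpolyUpTo k m) j ≡ 0ℚ

coef-lpolyUpTo-> k zero    (suc j) lt = refl
coef-lpolyUpTo-> k (suc m) j       lt = trans (coef-+ (lpolyUpTo k m) (monomial (suc m) (lcoef k m)) j)
  (cong₂ _+_ (coef-lpolyUpTo-> k m j (ℕₚ.<-trans (ℕₚ.n<1+n m) lt)) (coef-monomial-≢ (suc m) j (lcoef k m) (ℕₚ.<⇒≢ lt)))

coef-lpolyUpTo-≤ k zero zero le = sym (ℚₚ.*-identityˡ ((Y 1^ 0) k))
coef-lpolyUpTo-≤ k (suc m) j le with ℕₚ.m≤n⇒m<n∨m≡n le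
... | inj₁ (s≤s j≤m) = trans (coef-+ (lpolyUpTo k m) (monomial (suc m) (lcoef k m)) j)
  (trans (cong₂ _+_ (coef-lpolyUpTo-≤ k m j j≤m) (coef-monomial-≢ (suc m) j (lcoef k m) (λ e → ℕₚ.<⇒≢ (s≤s j≤m) (sym e))))
    (ℚₚ.+-identityʳ (invFact j * (Y 1^ j) k)))
... | inj₂ refl = trans (coef-+ (lpolyUpTo k m) (monomial (suc m) (lcoef k m)) (suc m))
  (trans (cong₂ _+_ (coef-lpolyUpTo-> k m (suc m) ℕₚ.≤-refl) (coef-monomial-≡ (suc m) (lcoef k m))) (ℚₚ.+-identityˡ (lcoef k m)))

-- `lpoly k` stops at `j = k`, but the formula persists beyond because `Y^j` has order at least `j`.
-- Freed of a bound on `j`, it can be differentiated coefficient by coefficient.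
coef-lpoly : ∀ k j → coef (lpoly k) j ≡ invFact j * (Y 1^ j) k
coef-lpoly k j with ℕₚ.≤-<-connex j k
... | inj₁ j≤k = trans (cong (λ p → coef p j) (lpoly≡ k)) (coef-lpolyUpTo-≤ k k j j≤k)
... | inj₂ k<j = trans (cong (λ p → coef p j) (lpoly≡ k)) (trans (coef-lpolyUpTo-> k k j k<j)
  (sym (trans (cong (invFact j *_) (Y^-order j k k<j)) (ℚₚ.*-zeroʳ (invFact j)))))

coef-D-lpoly : ∀ k j → coef (D (lpoly k)) j ≡ invFact j * (Y 1^ suc j) k
coef-D-lpoly k j = begin
  coef (D (lpoly k)) j                                     ≡⟨ coef-D (lpoly k) j ⟩
  ℕtoℚ (suc j) * coef (lpoly k) (suc j)                    ≡⟨ cong (ℕtoℚ (suc j) *_) (coef-lpoly k (suc j)) ⟩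
  ℕtoℚ (suc j) * (invFact (suc j) * (Y 1^ suc j) k)        ≡⟨ ℚₚ.*-assoc (ℕtoℚ (suc j)) (invFact (suc j)) _ ⟨
  ℕtoℚ (suc j) * invFact (suc j) * (Y 1^ suc j) k          ≡⟨ cong (_* (Y 1^ suc j) k) (invFact-suc j) ⟩
  invFact j * (Y 1^ suc j) k                               ∎

-- [y^{k+1}] of (1 + y) ∂L/∂t = y L for L = exp(t y / (1 + y)).
lpoly-recurrence : ∀ k → (D (lpoly (suc k)) ⊞ D (lpoly k)) ≋ lpoly k
lpoly-recurrence k = coeffwise λ j → begin
  coef (D (lpoly (suc k)) ⊞ D (lpoly k)) j
    ≡⟨ coef-+ (D (lpoly (suc k))) (D (lpoly k)) j ⟩
  coef (D (lpoly (suc k))) j + coef (D (lpoly k)) j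
    ≡⟨ cong₂ _+_ (coef-D-lpoly (suc k) j) (coef-D-lpoly k j) ⟩
  invFact j * (Y 1^ suc j) (suc k) + invFact j * (Y 1^ suc j) k         ≡⟨ ℚₚ.*-distribˡ-+ (invFact j) _ _ ⟨
  invFact j * ((Y 1^ suc j) (suc k) + (Y 1^ suc j) k)
    ≡⟨ cong (invFact j *_) (Y^-recurrence j k) ⟩
  invFact j * (Y 1^ j) k                                                ≡⟨ coef-lpoly k j ⟨
  coef (lpoly k) j                                                      ∎

coef-lpoly-suc-0 : ∀ k → coef (lpoly (suc k)) 0 ≡ 0ℚ
coef-lpoly-suc-0 k = coef-lpoly (suc k) 0

-- Finite sums and products of polynomials

psum< : ℕ → (ℕ → Poly) → Poly
psum< n f = psum (applyUpTo f n)

psum<-cong : ∀ n {f g : ℕ → Poly} → (∀ b → f b ≋ g b) → psum< n f ≋ psum< n g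
psum<-cong zero    e = ℙ.refl
psum<-cong (suc n) e = ℙ.+-cong (e 0) (psum<-cong n (e ∘ suc))

interchange : ∀ p q r s → (p ⊞ q) ⊞ (r ⊞ s) ≋ (p ⊞ r) ⊞ (q ⊞ s)
interchange = CS.interchange
  where import Algebra.Properties.CommutativeSemigroup ℙ.+-commutativeSemigroup as CS

psum<-+ : ∀ n f g → psum< n (λ b → f b ⊞ g b) ≋ psum< n f ⊞ psum< n g
psum<-+ zero    f g = ℙ.refl
psum<-+ (suc n) f g = ℙ.trans (ℙ.+-cong (ℙ.refl {f 0 ⊞ g 0}) (psum<-+ n (f ∘ suc) (g ∘ suc)))
  (interchange (f 0) (g 0) (psum< n (f ∘ suc)) (psum< n (g ∘ suc)))

psum<-last : ∀ n f → psum< (suc n) f ≋ psum< n f ⊞ f n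
psum<-last zero    f = ℙ.+-identityʳ (f 0)
psum<-last (suc n) f = ℙ.trans (ℙ.+-cong (ℙ.refl {f 0}) (psum<-last n (f ∘ suc)))
  (ℙ.sym (ℙ.+-assoc (f 0) (psum< n (f ∘ suc)) (f (suc n))))

D-psum< : ∀ n f → D (psum< n f) ≋ psum< n (D ∘ f)
D-psum< zero    f = ℙ.refl
D-psum< (suc n) f = ℙ.trans (D-+ (f 0) (psum< n (f ∘ suc))) (ℙ.+-cong (ℙ.refl {D (f 0)}) (D-psum< n (f ∘ suc)))

coef-psum<-zero : ∀ n f i → (∀ b → coef (f b) i ≡ 0ℚ) → coef (psum< n f) i ≡ 0ℚ
coef-psum<-zero zero    f i e = refl
coef-psum<-zero (suc n) f i e = trans (coef-+ (f 0) (psum< n (f ∘ suc)) i)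
  (cong₂ _+_ (e 0) (coef-psum<-zero n (f ∘ suc) i (e ∘ suc)))

scale-0 : ∀ {c} p → c ≡ 0ℚ → pscale c p ≋ []
scale-0 p refl = coeffwise λ n → trans (coef-scale 0ℚ p n) (ℚₚ.*-zeroˡ (coef p n))

scale-+ : ∀ c p q → pscale c (p ⊞ q) ≋ pscale c p ⊞ pscale c q
scale-+ c p q = coeffwise λ n → begin
  coef (pscale c (p ⊞ q)) n                   ≡⟨ coef-scale c (p ⊞ q) n ⟩
  c * coef (p ⊞ q) n                          ≡⟨ cong (c *_) (coef-+ p q n) ⟩
  c * (coef p n + coef q n)                   ≡⟨ ℚₚ.*-distribˡ-+ c _ _ ⟩
  c * coef p n + c * coef q n                 ≡⟨ cong₂ _+_ (coef-scale c p n) (coef-scale c q n) ⟨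
  coef (pscale c p) n + coef (pscale c q) n   ≡⟨ coef-+ (pscale c p) (pscale c q) n ⟨
  coef (pscale c p ⊞ pscale c q) n            ∎

+-scale : ∀ c d p → pscale (c + d) p ≋ pscale c p ⊞ pscale d p
+-scale c d p = coeffwise λ n → begin
  coef (pscale (c + d) p) n                   ≡⟨ coef-scale (c + d) p n ⟩
  (c + d) * coef p n                          ≡⟨ ℚₚ.*-distribʳ-+ (coef p n) c d ⟩
  c * coef p n + d * coef p n                 ≡⟨ cong₂ _+_ (coef-scale c p n) (coef-scale d p n) ⟨
  coef (pscale c p) n + coef (pscale d p) n   ≡⟨ coef-+ (pscale c p) (pscale d p) n ⟨
  coef (pscale c p ⊞ pscale d p) n            ∎

prodP sumP : ∀ {k} → (Fin k → Poly) → Poly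
prodP {zero}  f = 1ℚ ∷ []
prodP {suc k} f = f zero p* prodP (f ∘ suc)
sumP {zero}  f = []
sumP {suc k} f = f zero p+ sumP (f ∘ suc)

prodℚ sumℚ : ∀ {k} → (Fin k → ℚ) → ℚ
prodℚ {zero}  f = 1ℚ
prodℚ {suc k} f = f zero * prodℚ (f ∘ suc)
sumℚ {zero}  f = 0ℚ
sumℚ {suc k} f = f zero + sumℚ (f ∘ suc)

prodP-cong : ∀ {k} {f g : Fin k → Poly} → (∀ x → f x ≋ g x) → prodP f ≋ prodP g
prodP-cong {zero}  e = ℙ.refl
prodP-cong {suc k} e = ℙ.*-cong (e zero) (prodP-cong (e ∘ suc))

prodℚ-cong : ∀ {k} {f g : Fin k → ℚ} → (∀ x → f x ≡ g x) → prodℚ f ≡ prodℚ g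
prodℚ-cong {zero}  e = refl
prodℚ-cong {suc k} e = cong₂ _*_ (e zero) (prodℚ-cong (e ∘ suc))

sumℚ-cong : ∀ {k} {f g : Fin k → ℚ} → (∀ x → f x ≡ g x) → sumℚ f ≡ sumℚ g
sumℚ-cong {zero}  e = refl
sumℚ-cong {suc k} e = cong₂ _+_ (e zero) (sumℚ-cong (e ∘ suc))

prodℚ-zero : ∀ {k} (f : Fin k → ℚ) c → f c ≡ 0ℚ → prodℚ f ≡ 0ℚ
prodℚ-zero f zero    e = trans (cong (_* prodℚ (f ∘ suc)) e) (ℚₚ.*-zeroˡ (prodℚ (f ∘ suc)))
prodℚ-zero f (suc c) e = trans (cong (f zero *_) (prodℚ-zero (f ∘ suc) c e)) (ℚₚ.*-zeroʳ (f zero))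

sumℚ-zero : ∀ {k} (f : Fin k → ℚ) → (∀ x → f x ≡ 0ℚ) → sumℚ f ≡ 0ℚ
sumℚ-zero {zero}  f e = refl
sumℚ-zero {suc k} f e = trans (cong₂ _+_ (e zero) (sumℚ-zero (f ∘ suc) (e ∘ suc))) (ℚₚ.+-identityˡ 0ℚ)

sumℚ-replace : ∀ {k} (f g : Fin k → ℚ) c → (∀ x → c ≢ x → f x ≡ g x) → sumℚ f + g c ≡ sumℚ g + f c
sumℚ-replace f g zero    e = trans (solve 3 (λ a s b → a :+ s :+ b := b :+ s :+ a) refl (f zero) (sumℚ (f ∘ suc)) (g zero))
  (cong (λ s → g zero + s + f zero) (sumℚ-cong (λ x → e (suc x) λ ())))
sumℚ-replace f g (suc c) e = begin
  f zero + sumℚ (f ∘ suc) + g (suc c)     ≡⟨ ℚₚ.+-assoc (f zero) _ _ ⟩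
  f zero + (sumℚ (f ∘ suc) + g (suc c))
    ≡⟨ cong₂ _+_ (e zero λ ()) (sumℚ-replace (f ∘ suc) (g ∘ suc) c (λ x ne → e (suc x) λ { refl → ne refl })) ⟩
  g zero + (sumℚ (g ∘ suc) + f (suc c))   ≡⟨ ℚₚ.+-assoc (g zero) _ _ ⟨
  g zero + sumℚ (g ∘ suc) + f (suc c)     ∎

coef-prodP-0 : ∀ {k} (f : Fin k → Poly) → coef (prodP f) 0 ≡ prodℚ (λ x → coef (f x) 0)
coef-prodP-0 {zero}  f = refl
coef-prodP-0 {suc k} f = trans (coef-* (f zero) (prodP (f ∘ suc)) 0) (cong (coef (f zero) 0 *_) (coef-prodP-0 (f ∘ suc)))

Φ-sumP : ∀ {k} (f : Fin k → Poly) → Φ (sumP f) ≡ sumℚ (Φ ∘ f)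
Φ-sumP {zero}  f = refl
Φ-sumP {suc k} f = trans (Φ-+ (f zero) (sumP (f ∘ suc))) (cong (Φ (f zero) +_) (Φ-sumP (f ∘ suc)))

*-sumP : ∀ {k} p (f : Fin k → Poly) → p ⊠ sumP f ≋ sumP (λ x → p ⊠ f x)
*-sumP {zero}  p f = ℙ.zeroʳ p
*-sumP {suc k} p f = ℙ.trans (ℙ.distribˡ p (f zero) (sumP (f ∘ suc))) (ℙ.+-cong (ℙ.refl {p ⊠ f zero}) (*-sumP p (f ∘ suc)))

prodAt : ∀ {k} → (Fin k → Poly) → Fin k → Poly → Poly
prodAt f c p = prodP (updateAt f c (const p))

prodAt-cong : ∀ {k} (f : Fin k → Poly) c {p q} → p ≋ q → prodAt f c p ≋ prodAt f c q
prodAt-cong f zero    e = ℙ.*-cong e (ℙ.refl {prodP (f ∘ suc)})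
prodAt-cong f (suc c) e = ℙ.*-cong (ℙ.refl {f zero}) (prodAt-cong (f ∘ suc) c e)

prodAt-+ : ∀ {k} (f : Fin k → Poly) c p q → prodAt f c (p ⊞ q) ≋ prodAt f c p ⊞ prodAt f c q
prodAt-+ f zero    p q = ℙ.distribʳ (prodP (f ∘ suc)) p q
prodAt-+ f (suc c) p q = ℙ.trans (ℙ.*-cong (ℙ.refl {f zero}) (prodAt-+ (f ∘ suc) c p q))
  (ℙ.distribˡ (f zero) (prodAt (f ∘ suc) c p) (prodAt (f ∘ suc) c q))

prodAt-[] : ∀ {k} (f : Fin k → Poly) c → prodAt f c [] ≋ []
prodAt-[] f zero    = ℙ.refl
prodAt-[] f (suc c) = ℙ.trans (ℙ.*-cong (ℙ.refl {f zero}) (prodAt-[] (f ∘ suc) c)) (ℙ.zeroʳ (f zero))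

prodAt-prodP : ∀ {k} (f g : Fin k → Poly) c → (∀ x → c ≢ x → f x ≋ g x) → prodAt f c (g c) ≋ prodP g
prodAt-prodP f g zero    e = ℙ.*-cong (ℙ.refl {g zero}) (prodP-cong (λ x → e (suc x) λ ()))
prodAt-prodP f g (suc c) e = ℙ.*-cong (e zero λ ()) (prodAt-prodP (f ∘ suc) (g ∘ suc) c (λ x ne → e (suc x) λ { refl → ne refl }))

D-prodP : ∀ {k} (f : Fin k → Poly) → D (prodP f) ≋ sumP (λ c → prodAt f c (D (f c)))
D-prodP {zero}  f = ℙ.refl
D-prodP {suc k} f = ℙ.trans (D-* (f zero) (prodP (f ∘ suc)))
  (ℙ.+-cong (ℙ.refl {D (f zero) ⊠ prodP (f ∘ suc)})
    (ℙ.trans (ℙ.*-cong (ℙ.refl {f zero}) (D-prodP (f ∘ suc))) (*-sumP (f zero) (λ c → prodAt (f ∘ suc) c (D (f (suc c)))))))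

-- This has the shape of a sum over words: the constant terms account for the empty word, the
-- summand at `c` for the words that begin with `c`.
Φ-prodP-by-parts : ∀ {k} (f : Fin k → Poly) →
  Φ (prodP f) ≡ prodℚ (λ x → coef (f x) 0) + sumℚ (λ c → Φ (prodAt f c (D (f c))))
Φ-prodP-by-parts f = trans (Φ-by-parts (prodP f))
  (cong₂ _+_ (coef-prodP-0 f) (trans (Φ-cong (D-prodP f)) (Φ-sumP (λ c → prodAt f c (D (f c))))))

-- Words read by automata

on : ∀ {k} → Maybe (Fin k) → Fin k → Bool
on nothing  x = false
on (just c) x = does (c Fin.≟ x)

on-self : ∀ {k} (c : Fin k) → on (just c) c ≡ true
on-self c = dec-true (c Fin.≟ c) refl

on-other : ∀ {k} {c x : Fin k} → c ≢ x → on (just c) x ≡ false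
on-other {c = c} {x} = dec-false (c Fin.≟ x)

sumList : ∀ {A : Set} → (A → ℚ) → List A → ℚ
sumList f []       = 0ℚ
sumList f (x ∷ xs) = f x + sumList f xs

sumList-cong : ∀ {A : Set} {f g : A → ℚ} → (∀ x → f x ≡ g x) → ∀ xs → sumList f xs ≡ sumList g xs
sumList-cong e []       = refl
sumList-cong e (x ∷ xs) = cong₂ _+_ (e x) (sumList-cong e xs)

sumList-zero : ∀ {A : Set} {f : A → ℚ} → (∀ x → f x ≡ 0ℚ) → ∀ xs → sumList f xs ≡ 0ℚ
sumList-zero e []       = refl
sumList-zero e (x ∷ xs) = trans (cong₂ _+_ (e x) (sumList-zero e xs)) (ℚₚ.+-identityˡ 0ℚ)

sumList-++ : ∀ {A : Set} (f : A → ℚ) xs ys → sumList f (xs ++ ys) ≡ sumList f xs + sumList f ys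
sumList-++ f []       ys = sym (ℚₚ.+-identityˡ (sumList f ys))
sumList-++ f (x ∷ xs) ys = trans (cong (f x +_) (sumList-++ f xs ys)) (sym (ℚₚ.+-assoc (f x) (sumList f xs) (sumList f ys)))

sumList-map : ∀ {A B : Set} (f : B → ℚ) (g : A → B) xs → sumList f (map g xs) ≡ sumList (f ∘ g) xs
sumList-map f g []       = refl
sumList-map f g (x ∷ xs) = cong (f (g x) +_) (sumList-map f g xs)

sumList-concatMap : ∀ {A B : Set} {k} (f : B → ℚ) (g : A → List B) (h : Fin k → A) →
  sumList f (concatMap g (tabulate h)) ≡ sumℚ (λ x → sumList f (g (h x)))
sumList-concatMap {k = zero}  f g h = refl
sumList-concatMap {k = suc k} f g h = trans (sumList-++ f (g (h zero)) (concatMap g (tabulate (h ∘ suc))))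
  (cong (sumList f (g (h zero)) +_) (sumList-concatMap f g (h ∘ suc)))

sumList-allWords : ∀ k l (f : List (Fin k) → ℚ) →
  sumList f (allWords k (suc l)) ≡ sumℚ (λ c → sumList (λ w → f (c ∷ w)) (allWords k l))
sumList-allWords k l f = trans (sumList-concatMap f (λ c → map (c ∷_) (allWords k l)) (λ x → x))
  (sumℚ-cong (λ c → sumList-map f (c ∷_) (allWords k l)))

total : ∀ {k} → (Fin k → ℕ) → ℕ
total {zero}  α = 0
total {suc k} α = α zero ℕ.+ total (α ∘ suc)

total-zero : ∀ {k} (α : Fin k → ℕ) → total α ≡ 0 → ∀ x → α x ≡ 0
total-zero α e zero    = ℕₚ.m+n≡0⇒m≡0 (α zero) e
total-zero α e (suc x) = total-zero (α ∘ suc) (ℕₚ.m+n≡0⇒n≡0 (α zero) e) x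

total-suc : ∀ {k} (α : Fin k → ℕ) {l} → total α ≡ suc l → ∃ λ x → ∃ λ a → α x ≡ suc a
total-suc {suc k} α e with α zero in eq
... | suc a = zero , a , eq
... | zero with total-suc (α ∘ suc) e
... | x , a , eq′ = suc x , a , eq′

total-updateAt : ∀ {k} (α : Fin k → ℕ) c {a} → α c ≡ suc a → total α ≡ suc (total (updateAt α c (const a)))
total-updateAt α zero    e = cong (ℕ._+ total (α ∘ suc)) e
total-updateAt α (suc c) e = trans (cong (α zero ℕ.+_) (total-updateAt (α ∘ suc) c e)) (ℕₚ.+-suc (α zero) _)

-- Each letter carries a state of S.  Reading a letter x changes only the state of x, by ext if
-- x repeats the preceding letter (extends a run) and by new otherwise (starts a run).  The pair
-- (A, E) enumerates the run-length sequences by their length a and number b of new runs, E counting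
-- those that may first extend a run in progress.
module Automaton {S : Set} (new ext : S → S) (out : S → ℚ) where

  δ : Bool → S → S
  δ false = new
  δ true  = ext

  A E : S → ℕ → ℕ → ℚ
  A s zero    zero    = out s
  A s zero    (suc b) = 0ℚ
  A s (suc a) zero    = 0ℚ
  A s (suc a) (suc b) = E (new s) a b
  E s zero    b = A s zero b
  E s (suc a) b = A s (suc a) b + E (ext s) a b

  -- Every new run consumes a letter. This is what allows the sums in `TA` and `TE` to stop at
  -- `b = a`.
  A-vanishes : ∀ s a b → a ℕ.< b → A s a b ≡ 0ℚ
  E-vanishes : ∀ s a b → a ℕ.< b → E s a b ≡ 0ℚ
  A-vanishes s zero    (suc b) lt       = refl
  A-vanishes s (suc a) (suc b) (s≤s lt) = E-vanishes (new s) a b lt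
  E-vanishes s zero    b lt = A-vanishes s zero b lt
  E-vanishes s (suc a) b lt = trans (cong₂ _+_ (A-vanishes s (suc a) b lt) (E-vanishes (ext s) a b (ℕₚ.<⇒≤ lt)))
    (ℚₚ.+-identityˡ 0ℚ)

  -- `TE` is the operator `T'` applied to `E`; the shift to `suc b` accounts for the run already
  -- open, since `u^(b+1)` under `T` and then `D` gives `D (lpoly (suc b))`.
  TA TE : S → ℕ → Poly
  TA s a = psum< (suc a) (λ b → pscale (A s a b) (lpoly b))
  TE s a = psum< (suc a) (λ b → pscale (E s a b) (D (lpoly (suc b))))

  next : Bool → S → ℕ → Poly
  next f s zero    = []
  next f s (suc a) = TE (δ f s) a

  -- A nonempty sequence begins with a new run, so `A s` is `u x E(new s)` in positive length, and
  -- each `l_(b+1)` differentiates to the weight used in `TE`. In length 0 only the constant `l_0`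
  -- is present.
  D-TA : ∀ s a → D (TA s a) ≋ next false s a
  D-TA s zero    = ℙ.refl
  D-TA s (suc a) = ℙ.trans (D-psum< (suc (suc a)) (λ b → pscale (A s (suc a) b) (lpoly b)))
    (ℙ.trans (ℙ.+-cong (ℙ.trans (D-scale 0ℚ (lpoly 0)) (scale-0 (D (lpoly 0)) refl))
                       (psum<-cong (suc a) (λ b → D-scale (E (new s) a b) (lpoly (suc b)))))
      (ℙ.+-identityˡ (TE (new s) a)))

  -- `lpoly-recurrence` applied term by term: `T'F + (T F)' = T F` for `F = A s`.
  TA-split : ∀ s a → psum< (suc a) (λ b → pscale (A s a b) (D (lpoly (suc b)))) ⊞ D (TA s a) ≋ TA s a
  TA-split s a = ℙ.trans (ℙ.+-cong (ℙ.refl {psum< (suc a) f}) (ℙ.trans (D-psum< (suc a) (λ b → pscale (A s a b) (lpoly b)))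
      (psum<-cong (suc a) (λ b → D-scale (A s a b) (lpoly b)))))
    (ℙ.trans (ℙ.sym (psum<-+ (suc a) f g))
      (psum<-cong (suc a) (λ b → ℙ.trans (ℙ.sym (scale-+ (A s a b) (D (lpoly (suc b))) (D (lpoly b))))
        (scale-cong {A s a b} refl (lpoly-recurrence b)))))
    where
    f g : ℕ → Poly
    f b = pscale (A s a b) (D (lpoly (suc b)))
    g b = pscale (A s a b) (D (lpoly b))

  -- Follows from `E = A + x E(ext)` and `TA-split`. Combined with `D-TA` it says that passing from
  -- `TA` to `TE` exchanges the continuation by a new run for the one that extends the current run.
  TE-split : ∀ s a → TE s a ⊞ D (TA s a) ≋ TA s a ⊞ next true s a
  TE-split s zero    = ℙ.trans (TA-split s zero) (ℙ.sym (ℙ.+-identityʳ (TA s zero)))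
  TE-split s (suc a) = ℙ.trans (ℙ.+-cong TE-suc (ℙ.refl {D (TA s (suc a))}))
    (ℙ.trans (swap (psum< (suc (suc a)) f) (TE (ext s) a) (D (TA s (suc a))))
      (ℙ.+-cong (TA-split s (suc a)) (ℙ.refl {TE (ext s) a})))
    where
    f g : ℕ → Poly
    f b = pscale (A s (suc a) b) (D (lpoly (suc b)))
    g b = pscale (E (ext s) a b) (D (lpoly (suc b)))
    swap : ∀ p q r → (p ⊞ q) ⊞ r ≋ (p ⊞ r) ⊞ q
    swap p q r = ℙ.trans (ℙ.+-assoc p q r) (ℙ.trans (ℙ.+-cong (ℙ.refl {p}) (ℙ.+-comm q r)) (ℙ.sym (ℙ.+-assoc p r q)))
    TE-suc : TE s (suc a) ≋ psum< (suc (suc a)) f ⊞ TE (ext s) a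
    TE-suc = ℙ.trans (psum<-cong (suc (suc a)) (λ b → +-scale (A s (suc a) b) (E (ext s) a b) (D (lpoly (suc b)))))
      (ℙ.trans (psum<-+ (suc (suc a)) f g) (ℙ.+-cong (ℙ.refl {psum< (suc (suc a)) f})
        -- The sum on the left runs one index further than `TE (ext s) a`; its last term is zero
        -- because `a` letters cannot contain `a + 1` new runs.
        (ℙ.trans (psum<-last (suc a) g) (ℙ.trans (ℙ.+-cong (ℙ.refl {TE (ext s) a})
            (scale-0 (D (lpoly (suc (suc a)))) (E-vanishes (ext s) a (suc a) ℕₚ.≤-refl)))
          (ℙ.+-identityʳ (TE (ext s) a))))))

  value₀ : S → ℕ → ℚ
  value₀ s zero    = out s
  value₀ s (suc a) = 0ℚ

  -- At `t = 0` only `l_0` survives, and `u^0` occurs only for the empty sequence.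
  coef-TA-0 : ∀ s a → coef (TA s a) 0 ≡ value₀ s a
  coef-TA-0 s zero    = ℚₚ.*-identityʳ (out s)
  coef-TA-0 s (suc a) = coef-psum<-zero (suc (suc a)) (λ b → pscale (A s (suc a) b) (lpoly b)) 0 λ
    { zero    → trans (coef-scale 0ℚ (lpoly 0) 0) (ℚₚ.*-zeroˡ (coef (lpoly 0) 0))
    ; (suc b) → trans (coef-scale (E (new s) a b) (lpoly (suc b)) 0)
        (trans (cong (E (new s) a b *_) (coef-lpoly-suc-0 b)) (ℚₚ.*-zeroʳ (E (new s) a b))) }

  -- value x s f a w is out of the final state of x if x occurs a times in w and 0 otherwise;
  -- f tells whether the letter preceding w is x.
  value hit : ∀ {k} → Fin k → S → Bool → ℕ → List (Fin k) → ℚ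
  value x s f a []      = value₀ s a
  value x s f a (c ∷ w) = if on (just c) x then hit x s f a w else value x s false a w
  hit x s f zero    w = 0ℚ
  hit x s f (suc a) w = value x (δ f s) true a w

  module _ {k : ℕ} where

    -- Only the letter just read has an open run, hence at most one factor is a `TE`.
    factor : Maybe (Fin k) → (Fin k → S) → (Fin k → ℕ) → Fin k → Poly
    factor p q α x = if on p x then TE (q x) (α x) else TA (q x) (α x)

    weight : Maybe (Fin k) → (Fin k → S) → (Fin k → ℕ) → List (Fin k) → ℚ
    weight p q α w = prodℚ (λ x → value x (q x) (on p x) (α x) w)

    constant : (Fin k → S) → (Fin k → ℕ) → ℚ
    constant q α = prodℚ (λ x → value₀ (q x) (α x))

    module _ (q : Fin k → S) (α : Fin k → ℕ) where

      TAs : Fin k → Poly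
      TAs x = TA (q x) (α x)

      branch : Maybe (Fin k) → Fin k → Poly
      branch p c = prodAt TAs c (next (on p c) (q c) (α c))

      -- Without a preceding letter this is integration by parts with `D-TA`. With preceding letter
      -- `p`, `TE-split` expresses the product through that case; the summand `n⁻`, where `p` would
      -- open a new run, is traded for `n⁺`, where it extends the old one.
      Φ-factor : ∀ p → Φ (prodP (factor p q α)) ≡ constant q α + sumℚ (λ c → Φ (branch p c))
      Φ-factor nothing = trans (Φ-prodP-by-parts TAs)
        (cong₂ _+_ (prodℚ-cong (λ x → coef-TA-0 (q x) (α x)))
                   (sumℚ-cong (λ c → Φ-cong (prodAt-cong TAs c (D-TA (q c) (α c))))))
      Φ-factor (just p) = begin
        Φ (prodP F)                       ≡⟨ Φ-cong F≋ ⟩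
        Φ (prodAt TAs p TEp)
          ≡⟨ solve 2 (λ a b → a := a :+ b :+ (:- b)) refl (Φ (prodAt TAs p TEp)) n⁻ ⟩
        Φ (prodAt TAs p TEp) + n⁻ - n⁻    ≡⟨ cong (_- n⁻) split ⟩
        Φ (prodP TAs) + n⁺ - n⁻           ≡⟨ cong (λ z → z + n⁺ - n⁻) (Φ-factor nothing) ⟩
        c₀ + sumℚ s⁻ + n⁺ - n⁻
          ≡⟨ solve 4 (λ a b c d → a :+ b :+ c :+ (:- d) := a :+ (b :+ c) :+ (:- d)) refl c₀ (sumℚ s⁻) n⁺ n⁻ ⟩
        c₀ + (sumℚ s⁻ + n⁺) - n⁻          ≡⟨ cong (λ z → c₀ + z - n⁻) replace ⟩
        c₀ + (sumℚ s⁺ + n⁻) - n⁻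
          ≡⟨ solve 3 (λ a b d → a :+ (b :+ d) :+ (:- d) := a :+ b) refl c₀ (sumℚ s⁺) n⁻ ⟩
        c₀ + sumℚ s⁺                      ∎
        where
        F : Fin k → Poly
        F = factor (just p) q α
        TEp : Poly
        TEp = TE (q p) (α p)
        c₀ n⁻ n⁺ : ℚ
        c₀ = constant q α
        n⁻ = Φ (prodAt TAs p (next false (q p) (α p)))
        n⁺ = Φ (prodAt TAs p (next true (q p) (α p)))
        s⁻ s⁺ : Fin k → ℚ
        s⁻ c = Φ (branch nothing c)
        s⁺ c = Φ (branch (just p) c)
        factor-p : F p ≡ TEp
        factor-p = cong (λ b → if b then TEp else TAs p) (on-self p)
        F≋ : prodP F ≋ prodAt TAs p TEp
        F≋ = ℙ.sym (subst (λ z → prodAt TAs p z ≋ prodP F) factor-p (prodAt-prodP TAs F p (λ x ne →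
          ℙ.reflexive (cong (λ b → if b then TE (q x) (α x) else TAs x) (sym (on-other ne))))))
        split : Φ (prodAt TAs p TEp) + n⁻ ≡ Φ (prodP TAs) + n⁺
        split = begin
          Φ (prodAt TAs p TEp) + n⁻
            ≡⟨ cong (Φ (prodAt TAs p TEp) +_) (Φ-cong (prodAt-cong TAs p (D-TA (q p) (α p)))) ⟨
          Φ (prodAt TAs p TEp) + Φ (prodAt TAs p (D (TAs p)))
            ≡⟨ Φ-+ (prodAt TAs p TEp) (prodAt TAs p (D (TAs p))) ⟨
          Φ (prodAt TAs p TEp ⊞ prodAt TAs p (D (TAs p)))
            ≡⟨ Φ-cong (ℙ.trans (ℙ.sym (prodAt-+ TAs p TEp (D (TAs p)))) (ℙ.trans (prodAt-cong TAs p (TE-split (q p) (α p)))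
                 (prodAt-+ TAs p (TAs p) (next true (q p) (α p))))) ⟩
          Φ (prodAt TAs p (TAs p) ⊞ prodAt TAs p (next true (q p) (α p)))
            ≡⟨ Φ-+ (prodAt TAs p (TAs p)) (prodAt TAs p (next true (q p) (α p))) ⟩
          Φ (prodAt TAs p (TAs p)) + n⁺
            ≡⟨ cong (_+ n⁺) (Φ-cong (prodAt-prodP TAs TAs p (λ x _ → ℙ.refl))) ⟩
          Φ (prodP TAs) + n⁺ ∎
        replace : sumℚ s⁻ + n⁺ ≡ sumℚ s⁺ + n⁻
        replace = trans (cong (λ b → sumℚ s⁻ + Φ (prodAt TAs p (next b (q p) (α p)))) (sym (on-self p)))
          (sumℚ-replace s⁻ s⁺ p (λ x ne → cong (λ b → Φ (prodAt TAs x (next b (q x) (α x)))) (sym (on-other ne))))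

      module _ (p : Maybe (Fin k)) (c : Fin k) where

        q′ : Fin k → S
        q′ = updateAt q c (δ (on p c))

        α′ : ℕ → Fin k → ℕ
        α′ a = updateAt α c (const a)

        weight-∷-zero : α c ≡ 0 → ∀ w → weight p q α (c ∷ w) ≡ 0ℚ
        weight-∷-zero e w = prodℚ-zero _ c (trans
          (cong (λ b → if b then hit c (q c) (on p c) (α c) w else value c (q c) false (α c) w) (on-self c))
          (cong (λ a → hit c (q c) (on p c) a w) e))

        weight-∷-suc : ∀ {a} → α c ≡ suc a → ∀ w → weight p q α (c ∷ w) ≡ weight (just c) q′ (α′ a) w
        weight-∷-suc {a} e w = prodℚ-cong λ x → go x (c Fin.≟ x)
          where
          go : ∀ x → Dec (c ≡ x) →
               value x (q x) (on p x) (α x) (c ∷ w) ≡ value x (q′ x) (on (just c) x) (α′ a x) w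
          go x (no ne) = begin
            (if on (just c) x then hit x (q x) (on p x) (α x) w else value x (q x) false (α x) w)
              ≡⟨ cong (λ b → if b then hit x (q x) (on p x) (α x) w else value x (q x) false (α x) w) (on-other ne) ⟩
            value x (q x) false (α x) w
              ≡⟨ cong₂ (λ s n → value x s false n w) (updateAt-minimal x c q (ne ∘ sym)) (updateAt-minimal x c α (ne ∘ sym)) ⟨
            value x (q′ x) false (α′ a x) w
              ≡⟨ cong (λ b → value x (q′ x) b (α′ a x) w) (on-other ne) ⟨
            value x (q′ x) (on (just c) x) (α′ a x) w ∎
          go x (yes refl) = begin
            (if on (just x) x then hit x (q x) (on p x) (α x) w else value x (q x) false (α x) w)
              ≡⟨ cong (λ b → if b then hit x (q x) (on p x) (α x) w else value x (q x) false (α x) w) (on-self x) ⟩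
            hit x (q x) (on p x) (α x) w
              ≡⟨ cong (λ n → hit x (q x) (on p x) n w) e ⟩
            value x (δ (on p x) (q x)) true a w
              ≡⟨ cong₂ (λ s n → value x s true n w) (updateAt-updates x q) (updateAt-updates x α) ⟨
            value x (q′ x) true (α′ a x) w
              ≡⟨ cong (λ b → value x (q′ x) b (α′ a x) w) (on-self x) ⟨
            value x (q′ x) (on (just x) x) (α′ a x) w ∎

        branch-zero : α c ≡ 0 → Φ (branch p c) ≡ 0ℚ
        branch-zero e = Φ-cong (ℙ.trans (prodAt-cong TAs c (ℙ.reflexive (cong (next (on p c) (q c)) e))) (prodAt-[] TAs c))

        branch-suc : ∀ {a} → α c ≡ suc a → Φ (branch p c) ≡ Φ (prodP (factor (just c) q′ (α′ a)))
        branch-suc {a} e = Φ-cong (ℙ.trans (prodAt-cong TAs c (ℙ.reflexive (trans (cong (next (on p c) (q c)) e) (sym factor-c))))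
          (prodAt-prodP TAs (factor (just c) q′ (α′ a)) c λ x ne → ℙ.reflexive (sym (trans
            (cong (λ b → if b then TE (q′ x) (α′ a x) else TA (q′ x) (α′ a x)) (on-other ne))
            (cong₂ TA (updateAt-minimal x c q (ne ∘ sym)) (updateAt-minimal x c α (ne ∘ sym)))))))
          where
          factor-c : factor (just c) q′ (α′ a) c ≡ TE (δ (on p c) (q c)) a
          factor-c = trans (cong (λ b → if b then TE (q′ c) (α′ a c) else TA (q′ c) (α′ a c)) (on-self c))
            (cong₂ TE (updateAt-updates c q) (updateAt-updates c α))

    -- `Φ-factor` splits the right side as the choice of the first letter `c` splits the left. On
    -- both sides one occurrence of `c` is used up, the state of `c` advances, and `c` becomes the
    -- preceding letter; if no occurrence is left, both contributions are zero.
    sum-weight : ∀ l p q α → total α ≡ l → sumList (weight p q α) (allWords k l) ≡ Φ (prodP (factor p q α))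
    sum-weight zero p q α e = begin
      weight p q α [] + 0ℚ                              ≡⟨⟩
      constant q α + 0ℚ
        ≡⟨ cong (constant q α +_) (sumℚ-zero _ (λ c → branch-zero q α p c (total-zero α e c))) ⟨
      constant q α + sumℚ (λ c → Φ (branch q α p c))    ≡⟨ Φ-factor q α p ⟨
      Φ (prodP (factor p q α))                          ∎
    sum-weight (suc l) p q α e = begin
      sumList (weight p q α) (allWords k (suc l))
        ≡⟨ sumList-allWords k l (weight p q α) ⟩
      sumℚ (λ c → sumList (λ w → weight p q α (c ∷ w)) (allWords k l))
        ≡⟨ sumℚ-cong (λ c → step c (α c) refl) ⟩
      sumℚ (λ c → Φ (branch q α p c))                                   ≡⟨ ℚₚ.+-identityˡ _ ⟨
      0ℚ + sumℚ (λ c → Φ (branch q α p c))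
        ≡⟨ cong (_+ sumℚ (λ c → Φ (branch q α p c))) constant≡0 ⟨
      constant q α + sumℚ (λ c → Φ (branch q α p c))                    ≡⟨ Φ-factor q α p ⟨
      Φ (prodP (factor p q α))                                          ∎
      where
      step : ∀ c n → α c ≡ n → sumList (λ w → weight p q α (c ∷ w)) (allWords k l) ≡ Φ (branch q α p c)
      step c zero    αc = trans (sumList-zero (weight-∷-zero q α p c αc) (allWords k l)) (sym (branch-zero q α p c αc))
      step c (suc a) αc = begin
        sumList (λ w → weight p q α (c ∷ w)) (allWords k l)
          ≡⟨ sumList-cong (weight-∷-suc q α p c αc) (allWords k l) ⟩
        sumList (weight (just c) (q′ q α p c) (α′ q α p c a)) (allWords k l)
          ≡⟨ sum-weight l (just c) (q′ q α p c) (α′ q α p c a) (ℕₚ.suc-injective (trans (sym (total-updateAt α c αc)) e)) ⟩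
        Φ (prodP (factor (just c) (q′ q α p c) (α′ q α p c a)))
          ≡⟨ branch-suc q α p c αc ⟨
        Φ (branch q α p c) ∎
      constant≡0 : constant q α ≡ 0ℚ
      constant≡0 with total-suc α e
      ... | x , a , αx = prodℚ-zero _ x (cong (value₀ (q x)) αx)

-- Bivariate series

infix 4 _≐₂_
_≐₂_ : Ser2 → Ser2 → Set
f ≐₂ g = ∀ a b → f a b ≡ g a b

2*-⊛ : ∀ f g a b → (f 2* g) a b ≡ (f 𝕊².⊛ g) a b
2*-⊛ f g a b = begin
  sumTo a (λ c → sumTo b (λ d → f c d * g (a ∸ c) (b ∸ d)))  ≡⟨ sumTo-sum≤ a _ ⟩
  sum≤ a (λ c → sumTo b (λ d → f c d * g (a ∸ c) (b ∸ d)))   ≡⟨ sum≤-cong a (λ c → 1*-⊛ (f c) (g (a ∸ c)) b) ⟩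
  sum≤ a (λ c → (f c ⊛ g (a ∸ c)) b)                         ≡⟨ sum≤-pointwise a (λ c → f c ⊛ g (a ∸ c)) b ⟨
  𝕊².sum≤ a (λ c → f c ⊛ g (a ∸ c)) b                        ≡⟨ 𝕊².⊛-sum≤ a f g b ⟩
  (f 𝕊².⊛ g) a b                                             ∎

-- The homomorphism is the identity map; what has to be matched are the two forms of the product and
-- of the unit.
ser2Ring : CommutativeRing _ _
ser2Ring = commutativeRingVia
  {R = record { Carrier = Ser2 ; _≈_ = _≐₂_ ; _+_ = _2+_ ; _*_ = _2*_ ; -_ = λ f a b → - f a b ; 0# = λ _ _ → 0ℚ ; 1# = one2 }}
  𝕊².seriesRing {λ f → f} record
  { isRingHomomorphism = record
    { isSemiringHomomorphism = record
      { isNearSemiringHomomorphism = record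
        { +-isMonoidHomomorphism = record
          { isMagmaHomomorphism = record
            { isRelHomomorphism = record { cong = λ e → e }
            ; homo = λ _ _ _ _ → refl }
          ; ε-homo = λ _ _ → refl }
        ; *-homo = 2*-⊛ }
      ; 1#-homo = λ { zero zero → refl ; zero (suc _) → refl ; (suc _) _ → refl } }
    ; -‿homo = λ _ _ _ → refl }
  ; injective = λ e → e }

module 𝔾 = CommutativeRing ser2Ring
module 𝔾ₚ = PowerSeries ser2Ring

sumTo-local : ∀ n {f g} → (∀ i → i ℕ.≤ n → f i ≡ g i) → sumTo n f ≡ sumTo n g
sumTo-local zero    e = e 0 z≤n
sumTo-local (suc n) e = cong₂ _+_ (sumTo-local n (λ i le → e i (ℕₚ.m≤n⇒m≤1+n le))) (e (suc n) ℕₚ.≤-refl)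

sumTo-zero : ∀ n {f} → (∀ i → i ℕ.≤ n → f i ≡ 0ℚ) → sumTo n f ≡ 0ℚ
sumTo-zero n e = trans (sumTo-local n e) (zeros n)
  where
  zeros : ∀ n → sumTo n (λ _ → 0ℚ) ≡ 0ℚ
  zeros zero    = refl
  zeros (suc n) = trans (ℚₚ.+-identityʳ (sumTo n (λ _ → 0ℚ))) (zeros n)

2*-local : ∀ f {g h} a b → (∀ c d → c ℕ.≤ a → d ℕ.≤ b → g c d ≡ h c d) → (f 2* g) a b ≡ (f 2* h) a b
2*-local f a b e = sumTo-local a λ c _ → sumTo-local b λ d _ →
  cong (f c d *_) (e (a ∸ c) (b ∸ d) (ℕₚ.m∸n≤m a c) (ℕₚ.m∸n≤m b d))

2*-order : ∀ {h g} j → h 0 0 ≡ 0ℚ → (∀ a b → a ℕ.+ b ℕ.< j → g a b ≡ 0ℚ) →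
           ∀ a b → a ℕ.+ b ℕ.< suc j → (h 2* g) a b ≡ 0ℚ
2*-order {h} {g} j e v a b (s≤s lt) = sumTo-zero a λ c c≤a → sumTo-zero b λ d d≤b → term c d c≤a d≤b
  where
  right : ∀ c d → a ∸ c ℕ.+ (b ∸ d) ℕ.< a ℕ.+ b → h c d * g (a ∸ c) (b ∸ d) ≡ 0ℚ
  right c d lt′ = trans (cong (h c d *_) (v (a ∸ c) (b ∸ d) (ℕₚ.<-≤-trans lt′ lt))) (ℚₚ.*-zeroʳ (h c d))
  term : ∀ c d → c ℕ.≤ a → d ℕ.≤ b → h c d * g (a ∸ c) (b ∸ d) ≡ 0ℚ
  term zero    zero    _ _ = trans (cong (_* g a b) e) (ℚₚ.*-zeroˡ (g a b))
  term (suc c) d       c≤a d≤b = right (suc c) d (ℕₚ.+-mono-<-≤ (ℕₚ.∸-monoʳ-< (s≤s z≤n) c≤a) (ℕₚ.m∸n≤m b d))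
  term zero    (suc d) c≤a d≤b = right zero (suc d) (ℕₚ.+-monoʳ-< a (ℕₚ.∸-monoʳ-< (s≤s z≤n) d≤b))

2^-order : ∀ {h} → h 0 0 ≡ 0ℚ → ∀ j a b → a ℕ.+ b ℕ.< j → (h 2^ j) a b ≡ 0ℚ
2^-order e zero    a b ()
2^-order {h} e (suc j) a b lt = 2*-order {h} {h 2^ j} j e (2^-order {h} e j) a b lt

2^≡pow : ∀ f j → f 2^ j ≡ 𝔾ₚ.pow f j
2^≡pow f zero    = refl
2^≡pow f (suc j) = cong (f 2*_) (2^≡pow f j)

sum≤₂-pointwise : ∀ m (F : ℕ → Ser2) a b → 𝔾ₚ.sum≤ m F a b ≡ sumTo m (λ j → F j a b)
sum≤₂-pointwise zero    F a b = refl
sum≤₂-pointwise (suc m) F a b = cong (_+ F (suc m) a b) (sum≤₂-pointwise m F a b)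

-- The argument of `inv1-inverseʳ` with the total degree `a + b` as cutoff.
inv2-inverseʳ : ∀ f → f 0 0 ≡ 1ℚ → f 2* inv2 f ≐₂ one2
inv2-inverseʳ f f00 a b = begin
  (f 2* inv2 f) a b
    ≡⟨ 2*-local f {inv2 f} {S} a b inv2≡S ⟩
  (f 2* S) a b
    ≡⟨ ℚₚ.+-identityʳ ((f 2* S) a b) ⟨
  (f 2* S) a b + 0ℚ
    ≡⟨ cong ((f 2* S) a b +_) (trans (cong (λ z → z a b) (sym (2^≡pow h (suc n)))) (2^-order {h} h00 (suc n) a b ℕₚ.≤-refl)) ⟨
  (f 2* S) a b + 𝔾ₚ.pow h (suc n) a b
    ≡⟨ 𝔾ₚ.geometric f h (λ a b → solve 2 (λ x y → x :+ (y :+ (:- x)) := y) refl (f a b) (one2 a b)) n a b ⟩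
  one2 a b ∎
  where
  n : ℕ
  n = a ℕ.+ b
  h S : Ser2
  h = one2 2- f
  S = 𝔾ₚ.sum≤ n (𝔾ₚ.pow h)
  h00 : h 0 0 ≡ 0ℚ
  h00 = cong (λ z → 1ℚ - z) f00
  inv2≡S : ∀ c d → c ℕ.≤ a → d ℕ.≤ b → inv2 f c d ≡ S c d
  inv2≡S c d c≤a d≤b = begin
    sumTo (c ℕ.+ d) (λ j → (h 2^ j) c d)   ≡⟨ sumTo-sum≤ (c ℕ.+ d) _ ⟩
    sum≤ (c ℕ.+ d) (λ j → (h 2^ j) c d)
      ≡⟨ sum≤-extend′ (λ j → (h 2^ j) c d) (ℕₚ.+-mono-≤ c≤a d≤b) (λ j → 2^-order {h} h00 j c d) ⟨
    sum≤ n (λ j → (h 2^ j) c d)            ≡⟨ sumTo-sum≤ n (λ j → (h 2^ j) c d) ⟨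
    sumTo n (λ j → (h 2^ j) c d)           ≡⟨ sumTo-cong n (λ j → cong (λ z → z c d) (2^≡pow h j)) ⟩
    sumTo n (λ j → 𝔾ₚ.pow h j c d)         ≡⟨ sum≤₂-pointwise n (𝔾ₚ.pow h) c d ⟨
    S c d                                  ∎

X≐y : ∀ a b → X a b ≡ 𝕊².y a b
X≐y zero          b       = refl
X≐y 1             zero    = refl
X≐y 1             (suc b) = refl
X≐y (suc (suc a)) b       = refl

X-zero : ∀ f b → (X 2* f) 0 b ≡ 0ℚ
X-zero f b = trans (2*-⊛ X f 0 b) (trans (𝕊².⊛-cong {X} {𝕊².y} {f} {f} X≐y (λ _ _ → refl) 0 b) (𝕊².y⊛-zero f b))

X-suc : ∀ f a b → (X 2* f) (suc a) b ≡ f a b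
X-suc f a b = trans (2*-⊛ X f (suc a) b)
  (trans (𝕊².⊛-cong {X} {𝕊².y} {f} {f} X≐y (λ _ _ → refl) (suc a) b) (𝕊².y⊛-suc f a b))

U-row : ∀ f a b → (U 2* f) a b ≡ (𝕊.y ⊛ f a) b
U-row f a b = trans (2*-⊛ U f a b) (row a)
  where
  U0 : ∀ b → U 0 b ≡ 𝕊.y b
  U0 0             = refl
  U0 1             = refl
  U0 (suc (suc b)) = refl
  row : ∀ a → (U 𝕊².⊛ f) a b ≡ (𝕊.y ⊛ f a) b
  row zero    = ⊛-cong {U 0} {𝕊.y} {f 0} {f 0} U0 (λ _ → refl) b
  row (suc a) = trans (cong₂ _+_ (⊛-cong {U 0} {𝕊.y} {f (suc a)} {f (suc a)} U0 (λ _ → refl) b)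
      (trans (𝕊².⊛-cong {𝕊².tail U} {𝕊².𝟘} {f} {f} (λ _ _ → refl) (λ _ _ → refl) a b) (𝕊².⊛-zeroˡ f a b)))
    (ℚₚ.+-identityʳ ((𝕊.y ⊛ f (suc a)) b))

U-zero : ∀ f a → (U 2* f) a 0 ≡ 0ℚ
U-zero f a = trans (U-row f a 0) (y⊛-zero (f a))

U-suc : ∀ f a b → (U 2* f) a (suc b) ≡ f a b
U-suc f a b = trans (U-row f a (suc b)) (y⊛-suc (f a) b)

-- The pattern automaton and the series G_τ

open Blocks ser2Ring

-- Blocks of a pattern are represented by the predecessors of their sizes.  In state at r m ms the
-- current block has size suc m, r + 1 of its letters are still to be read, and ms are the later blocks.
data State : Set where
  done : State
  at   : (r m : ℕ) (ms : List ℕ) → State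

start : List ℕ → State
start []       = done
start (m ∷ ms) = at m m ms

-- Consecutive blocks of the pattern may touch, so a completed block leads to the next one within
-- the same run. A new run discards a partial block; its first letter is itself read, which is why
-- `new` ends with an `ext`.
ext new : State → State
ext done             = done
ext (at zero    m ms) = start ms
ext (at (suc r) m ms) = at r m ms
new done        = done
new (at r m ms) = ext (at m m ms)

matched unmatched everything : State → ℚ
matched done       = 1ℚ
matched (at _ _ _) = 0ℚ
unmatched done       = 0ℚ
unmatched (at _ _ _) = 1ℚ
everything _ = 1ℚ

module Matched  = Automaton new ext matched
module Unmatched = Automaton new ext unmatched
module Everything = Automaton new ext everything

E-unfold : ∀ s → Matched.E s ≐₂ Matched.A s 2+ (X 2* Matched.E (ext s))
E-unfold s zero    b = sym (trans (cong (Matched.A s 0 b +_) (X-zero (Matched.E (ext s)) b)) (ℚₚ.+-identityʳ (Matched.A s 0 b)))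
E-unfold s (suc a) b = cong (Matched.A s (suc a) b +_) (sym (X-suc (Matched.E (ext s)) a b))

-- A new run discards the progress in the current block, so `r` disappears on the right.
A-at : ∀ r m ms → Matched.A (at r m ms) ≐₂ U 2* (X 2* Matched.E (ext (at m m ms)))
A-at r m ms zero    zero    = sym (U-zero (X 2* Matched.E (ext (at m m ms))) 0)
A-at r m ms zero    (suc b) = sym (trans (U-suc (X 2* Matched.E (ext (at m m ms))) 0 b) (X-zero (Matched.E (ext (at m m ms))) b))
A-at r m ms (suc a) zero    = sym (U-zero (X 2* Matched.E (ext (at m m ms))) (suc a))
A-at r m ms (suc a) (suc b) = sym (trans (U-suc (X 2* Matched.E (ext (at m m ms))) (suc a) b) (X-suc (Matched.E (ext (at m m ms))) a b))

A-done : Matched.A done ≐₂ one2 2+ (U 2* (X 2* Matched.E done))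
A-done zero    zero    = sym (cong (1ℚ +_) (U-zero (X 2* Matched.E done) 0))
A-done zero    (suc b) = sym (trans (cong (0ℚ +_) (trans (U-suc (X 2* Matched.E done) 0 b) (X-zero (Matched.E done) b))) (ℚₚ.+-identityˡ 0ℚ))
A-done (suc a) zero    = sym (trans (cong (0ℚ +_) (U-zero (X 2* Matched.E done) (suc a))) (ℚₚ.+-identityˡ 0ℚ))
A-done (suc a) (suc b) = sym (trans (cong (0ℚ +_) (trans (U-suc (X 2* Matched.E done) (suc a) b) (X-suc (Matched.E done) a b)))
  (ℚₚ.+-identityˡ (Matched.E done a b)))

Dm-00 : ∀ m → Dm m 0 0 ≡ 1ℚ
Dm-00 m = cong (λ z → 1ℚ - z) (U-zero (X 2- (X 2^ m)) 0)

D0-00 : D0 0 0 ≡ 1ℚ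
D0-00 = cong (λ z → 1ℚ - z) (U-zero X 0)

E-done : Matched.E done ≐₂ inv2 D0
E-done = final-run {X} {U} {one2 2- X} {D0} {inv2 D0} {Matched.A done} {Matched.E done}
  (-‿split one2 X) (-‿split (one2 2- X) (U 2* X)) (inv2-inverseʳ D0 D0-00) (E-unfold done) A-done

module _ (m : ℕ) (ms : List ℕ) where
  private
    a e′ e : Ser2
    a = Matched.A (at m m ms)
    e′ = Matched.E (start ms)
    e = Matched.E (at m m ms)

    A-at-r : ∀ r → Matched.A (at r m ms) ≐₂ a
    A-at-r r = 𝔾.trans {Matched.A (at r m ms)} {U 2* (X 2* Matched.E (ext (at m m ms)))} {a} (A-at r m ms)
      (𝔾.sym {a} {U 2* (X 2* Matched.E (ext (at m m ms)))} (A-at m m ms))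

    step : ∀ r → Matched.E (at r m ms) ≐₂ a 2+ (X 2* Matched.E (ext (at r m ms)))
    step r i j = trans (E-unfold (at r m ms) i j) (cong (_+ (X 2* Matched.E (ext (at r m ms))) i j) (A-at-r r i j))

    e≈ : e ≐₂ (a 2* geom X m) 2+ ((X 2^ suc m) 2* e′)
    e≈ i j = trans (run-expansion X a e′ (λ r → Matched.E (at r m ms)) (step 0) (λ r → step (suc r)) m i j)
      (cong (λ p → ((a 2* geom X m) 2+ (p 2* e′)) i j) (sym (2^≡pow X (suc m))))

    geom≈ : (geom X m 2* (one2 2- X)) 2+ (X 2^ suc m) ≐₂ one2
    geom≈ i j = trans (cong (λ p → ((geom X m 2* (one2 2- X)) 2+ p) i j) (2^≡pow X (suc m)))
      (geom-sum X (one2 2- X) (-‿split one2 X) m i j)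

    -- One continuation serves twice: `e` is `a + xe`, and `U 2* xe` is `a` again, because a new run
    -- and an extension move an untouched block to the same state.
    ue : U 2* e ≐₂ (U 2* a) 2+ a
    ue i j = trans (𝔾.*-cong {U} {U} {e} {a 2+ xe} (λ _ _ → refl) (step m) i j)
      (trans (𝔾.distribˡ U a xe i j) (cong ((U 2* a) i j +_) (sym (A-at m m ms i j))))
      where
      xe : Ser2
      xe = X 2* Matched.E (ext (at m m ms))

    qp : (one2 2- (X 2^ suc m)) 2+ (X 2^ suc m) ≐₂ one2
    qp = -‿split one2 (X 2^ suc m)

    den : Dm (suc m) 2+ (U 2* (X 2- (X 2^ suc m))) ≐₂ (one2 2- X)
    den = -‿split (one2 2- X) (U 2* (X 2- (X 2^ suc m)))

  A-block : a ≐₂ ((((U 2* (X 2^ suc m)) 2* (one2 2- X)) 2* inv2 (Dm (suc m))) 2* e′)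
  A-block = block-new {X} {U} {one2 2- X} {X 2^ suc m} {one2 2- (X 2^ suc m)}
    {Dm (suc m)} {inv2 (Dm (suc m))} {geom X m} {a} {e} {e′}
    (-‿split one2 X) qp den (inv2-inverseʳ (Dm (suc m)) (Dm-00 (suc m))) geom≈ e≈ ue

  E-block : e ≐₂ bracket (suc m) 2* e′
  E-block = block-run {X} {U} {one2 2- X} {X 2^ suc m} {one2 2- (X 2^ suc m)}
    {Dm (suc m)} {inv2 (Dm (suc m))} {geom X m} {a} {e} {e′}
    (-‿split one2 X) qp den (inv2-inverseʳ (Dm (suc m)) (Dm-00 (suc m))) geom≈ e≈ ue

brackets : List ℕ → Ser2
brackets = foldr (λ m acc → bracket m 2* acc) one2

E-start : ∀ ms → Matched.E (start ms) ≐₂ inv2 D0 2* brackets (map suc ms)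
E-start []       a b = trans (E-done a b) (sym (𝔾.*-identityʳ (inv2 D0) a b))
E-start (m ∷ ms) a b = begin
  Matched.E (at m m ms) a b                                          ≡⟨ E-block m ms a b ⟩
  (bracket (suc m) 2* Matched.E (start ms)) a b
    ≡⟨ 𝔾.*-cong {bracket (suc m)} {bracket (suc m)} {Matched.E (start ms)} {i 2* bs} (λ _ _ → refl) (E-start ms) a b ⟩
  (bracket (suc m) 2* (i 2* bs)) a b                           ≡⟨ x∙yz≈y∙xz (bracket (suc m)) i bs a b ⟩
  (i 2* (bracket (suc m) 2* bs)) a b                           ∎
  where
  open import Algebra.Properties.CommutativeSemigroup 𝔾.*-commutativeSemigroup using (x∙yz≈y∙xz)
  i bs : Ser2
  i = inv2 D0
  bs = brackets (map suc ms)

-- The first block contributes a factor of another form than the later ones: no run is open at the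
-- start of a word, so it is governed by `A`, while a later block may begin in the run that
-- completed its predecessor and is governed by `E`.
A-G : ∀ m ms → Matched.A (at m m ms) ≐₂ G (suc m) (map suc ms)
A-G m ms a b = begin
  Matched.A (at m m ms) a b              ≡⟨ A-block m ms a b ⟩
  (k 2* Matched.E (start ms)) a b
    ≡⟨ 𝔾.*-cong {k} {k} {Matched.E (start ms)} {i 2* bs} (λ _ _ → refl) (E-start ms) a b ⟩
  (k 2* (i 2* bs)) a b             ≡⟨ 𝔾.*-assoc k i bs a b ⟨
  ((k 2* i) 2* bs) a b             ∎
  where
  k i bs : Ser2
  k = ((U 2* (X 2^ suc m)) 2* (one2 2- X)) 2* inv2 (Dm (suc m))
  i = inv2 D0
  bs = brackets (map suc ms)

-- Avoidance as a complement: the factor of one letter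

A-+ : ∀ s a b → Unmatched.A s a b + Matched.A s a b ≡ Everything.A s a b
E-+ : ∀ s a b → Unmatched.E s a b + Matched.E s a b ≡ Everything.E s a b
A-+ done       zero    zero    = refl
A-+ (at _ _ _) zero    zero    = refl
A-+ s          zero    (suc b) = ℚₚ.+-identityˡ 0ℚ
A-+ s          (suc a) zero    = ℚₚ.+-identityˡ 0ℚ
A-+ s          (suc a) (suc b) = E-+ (new s) a b
E-+ s          zero    b       = A-+ s zero b
E-+ s          (suc a) b       = trans
  (solve 4 (λ u v w z → (u :+ v) :+ (w :+ z) := (u :+ w) :+ (v :+ z)) refl
    (Unmatched.A s (suc a) b) (Unmatched.E (ext s) a b) (Matched.A s (suc a) b) (Matched.E (ext s) a b))
  (cong₂ _+_ (A-+ s (suc a) b) (E-+ (ext s) a b))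

TA-+ : ∀ s a → Unmatched.TA s a ⊞ Matched.TA s a ≋ Everything.TA s a
TA-+ s a = ℙ.trans (ℙ.sym (psum<-+ (suc a) (λ b → pscale (Unmatched.A s a b) (lpoly b)) (λ b → pscale (Matched.A s a b) (lpoly b))))
  (psum<-cong (suc a) (λ b → ℙ.trans (ℙ.sym (+-scale (Unmatched.A s a b) (Matched.A s a b) (lpoly b)))
    (scale-cong (A-+ s a b) (ℙ.refl {lpoly b}))))

D-injective : ∀ {p q} → coef p 0 ≡ coef q 0 → D p ≋ D q → p ≋ q
D-injective {p} {q} e₀ e = coeffwise λ { zero → e₀ ; (suc n) → begin
  coef p (suc n)                                                   ≡⟨ divide n (coef p (suc n)) ⟨
  (ℤ.+ 1 / suc n) * (ℕtoℚ (suc n) * coef p (suc n))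
    ≡⟨ cong ((ℤ.+ 1 / suc n) *_) (trans (sym (coef-D p n)) (trans (coef-≡ e n) (coef-D q n))) ⟩
  (ℤ.+ 1 / suc n) * (ℕtoℚ (suc n) * coef q (suc n))     ≡⟨ divide n (coef q (suc n)) ⟩
  coef q (suc n)                                                   ∎ }
  where
  divide : ∀ n c → (ℤ.+ 1 / suc n) * (ℕtoℚ (suc n) * c) ≡ c
  divide n c = trans (sym (ℚₚ.*-assoc (ℤ.+ 1 / suc n) (ℕtoℚ (suc n)) c))
    (trans (cong (_* c) (recip (suc n))) (ℚₚ.*-identityˡ c))

expTerm : ℕ → Poly
expTerm a = monomial a (invFact a)

D-expTerm : ∀ a → D (expTerm (suc a)) ≋ expTerm a
D-expTerm a = coeffwise λ n → trans (coef-D (expTerm (suc a)) n) (go n (a ℕ.≟ n))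
  where
  go : ∀ n → Dec (a ≡ n) → ℕtoℚ (suc n) * coef (expTerm (suc a)) (suc n) ≡ coef (expTerm a) n
  go n (yes refl) = trans (cong (ℕtoℚ (suc a) *_) (coef-monomial-≡ a (invFact (suc a))))
    (trans (invFact-suc a) (sym (coef-monomial-≡ a (invFact a))))
  go n (no ne) = trans (cong (ℕtoℚ (suc n) *_) (coef-monomial-≢ a n (invFact (suc a)) ne))
    (trans (ℚₚ.*-zeroʳ (ℕtoℚ (suc n))) (sym (coef-monomial-≢ a n (invFact a) ne)))

-- When all states accept, `new` and `ext` lead to the same series, so `TE-split` collapses to
-- `TE = TA`. Then `D-TA` makes each `TA` the derivative of the next, which together with the
-- constant terms characterises `t^a / a!`.
TA-everything : ∀ s a → Everything.TA s a ≋ expTerm a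
TE-everything : ∀ s a → Everything.TE s a ≋ expTerm a
TA-everything s zero    = coeffwise λ { zero → refl ; (suc n) → refl }
TA-everything s (suc a) = D-injective (Everything.coef-TA-0 s (suc a))
  (ℙ.trans (Everything.D-TA s (suc a)) (ℙ.trans (TE-everything (new s) a) (ℙ.sym (D-expTerm a))))
TE-everything s a = ℙ.trans (∙-cancelʳ (D (Everything.TA s a)) (Everything.TE s a) (Everything.TA s a)
    (ℙ.trans (Everything.TE-split s a) (ℙ.+-cong (ℙ.refl {Everything.TA s a}) (next≋ s a)))) (TA-everything s a)
  where
  open import Algebra.Properties.Group ℙ.+-group using (∙-cancelʳ)
  next≋ : ∀ s a → Everything.next true s a ≋ D (Everything.TA s a)
  next≋ s zero    = ℙ.refl
  next≋ s (suc a) = ℙ.trans (TE-everything (ext s) a) (ℙ.trans (ℙ.sym (TE-everything (new s) a)) (ℙ.sym (Everything.D-TA s (suc a))))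

TG-TA : ∀ m ms a → TG (suc m) (map suc ms) a ≋ Matched.TA (at m m ms) a
TG-TA m ms a = ℙ.trans (ℙ.reflexive (cong psum (map-upTo (λ b → pscale (G (suc m) (map suc ms) a b) (lpoly b)) (suc a))))
  (psum<-cong (suc a) (λ b → scale-cong (sym (A-G m ms a b)) (ℙ.refl {lpoly b})))

factorCoeff-TA : ∀ m ms a → factorCoeff (suc m) (map suc ms) a ≋ Unmatched.TA (at m m ms) a
factorCoeff-TA m ms a = ℙ.trans (ℙ.+-cong (ℙ.trans (ℙ.sym (TA-everything s a)) (ℙ.sym (TA-+ s a))) (ℙ.-‿cong (TG-TA m ms a)))
  (ℙ.trans (ℙ.+-assoc (Unmatched.TA s a) (Matched.TA s a) (p- (Matched.TA s a)))
    (ℙ.trans (ℙ.+-cong (ℙ.refl {Unmatched.TA s a}) (ℙ.-‿inverseʳ (Matched.TA s a))) (ℙ.+-identityʳ (Unmatched.TA s a))))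
  where
  s : State
  s = at m m ms

-- Coefficients of the product over the letters

psumMap : ∀ {A : Set} → (A → Poly) → List A → Poly
psumMap f xs = psum (map f xs)

psumMap-cong : ∀ {A : Set} {f g : A → Poly} → (∀ x → f x ≋ g x) → ∀ xs → psumMap f xs ≋ psumMap g xs
psumMap-cong e []       = ℙ.refl
psumMap-cong e (x ∷ xs) = ℙ.+-cong (e x) (psumMap-cong e xs)

psumMap-[] : ∀ {A : Set} {f : A → Poly} → (∀ x → f x ≋ []) → ∀ xs → psumMap f xs ≋ []
psumMap-[] e []       = ℙ.refl
psumMap-[] e (x ∷ xs) = ℙ.+-cong (e x) (psumMap-[] e xs)

psumMap-++ : ∀ {A : Set} (f : A → Poly) xs ys → psumMap f (xs ++ ys) ≋ psumMap f xs ⊞ psumMap f ys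
psumMap-++ f []       ys = ℙ.refl
psumMap-++ f (x ∷ xs) ys = ℙ.trans (ℙ.+-cong (ℙ.refl {f x}) (psumMap-++ f xs ys))
  (ℙ.sym (ℙ.+-assoc (f x) (psumMap f xs) (psumMap f ys)))

psumMap-map : ∀ {A B : Set} (f : B → Poly) (g : A → B) xs → psumMap f (map g xs) ≡ psumMap (f ∘ g) xs
psumMap-map f g []       = refl
psumMap-map f g (x ∷ xs) = cong (f (g x) p+_) (psumMap-map f g xs)

psumMap-concatMap : ∀ {A B : Set} (f : B → Poly) (g : A → List B) xs →
  psumMap f (concatMap g xs) ≋ psumMap (psumMap f ∘ g) xs
psumMap-concatMap f g []       = ℙ.refl
psumMap-concatMap f g (x ∷ xs) = ℙ.trans (psumMap-++ f (g x) (concatMap g xs))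
  (ℙ.+-cong (ℙ.refl {psumMap f (g x)}) (psumMap-concatMap f g xs))

psum<-[] : ∀ n {f : ℕ → Poly} → (∀ b → b ℕ.< n → f b ≋ []) → psum< n f ≋ []
psum<-[] zero    e = ℙ.refl
psum<-[] (suc n) e = ℙ.+-cong (e 0 (s≤s z≤n)) (psum<-[] n (λ b lt → e (suc b) (s≤s lt)))

psumMap-below : ∀ {k} (f : Vec ℕ (suc k) → Poly) a (α : Vec ℕ k) →
  psumMap f (below (a ∷ α)) ≋ psum< (suc a) (λ c → psumMap (λ β → f (c ∷ β)) (below α))
psumMap-below f a α = ℙ.trans (psumMap-concatMap f (λ c → map (c ∷_) (below α)) (upTo (suc a)))
  (ℙ.trans (psumMap-cong (λ c → ℙ.reflexive (psumMap-map f (c ∷_) (below α))) (upTo (suc a)))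
    (ℙ.reflexive (cong psum (map-upTo (λ c → psumMap (λ β → f (c ∷ β)) (below α)) (suc a)))))

psumMap-isZeroVec : ∀ {k} p (h : MSer k) α →
  psumMap (λ β → (if isZeroVec β then p else []) p* h (zipWith _∸_ α β)) (below α) ≋ p ⊠ h α
psumMap-isZeroVec p h []      = ℙ.+-identityʳ (p ⊠ h [])
psumMap-isZeroVec p h (a ∷ α) = ℙ.trans (psumMap-below _ a α)
  (ℙ.trans (ℙ.+-cong (psumMap-isZeroVec p (h ∘ (a ∷_)) α)
                     (psum<-[] a (λ c _ → psumMap-[] (λ β → ℙ.refl) (below α))))
    (ℙ.+-identityʳ (p ⊠ h (a ∷ α))))

module _ (F : ℕ → Poly) where

  -- General index maps `g` are needed because the list of factors shrinks in the induction while
  -- the number of variables stays.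
  ∏embed : ∀ {n k} → (Fin n → Fin k) → MSer k
  ∏embed g = foldr (λ i acc → embed i F m* acc) mone (tabulate g)

  ∏embed-suc-zero : ∀ {n k} (g : Fin n → Fin k) β → ∏embed (Fin.suc ∘ g) (0 ∷ β) ≋ ∏embed g β
  ∏embed-suc-suc : ∀ {n k} (g : Fin n → Fin k) c β → ∏embed (Fin.suc ∘ g) (suc c ∷ β) ≋ []

  ∏embed-suc-zero {zero}  g β = ℙ.refl
  ∏embed-suc-zero {suc n} g β = ℙ.trans (psumMap-below _ 0 β) (ℙ.trans (ℙ.+-identityʳ _)
    (psumMap-cong (λ γ → ℙ.*-cong (ℙ.refl {embed (g zero) F γ}) (∏embed-suc-zero (g ∘ Fin.suc) (zipWith _∸_ β γ))) (below β)))
  ∏embed-suc-suc {zero}  g c β = ℙ.refl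
  ∏embed-suc-suc {suc n} g c β = ℙ.trans (psumMap-below _ (suc c) β) (psum<-[] (suc (suc c))
    {f = λ d → psumMap (λ γ → embed (Fin.suc (g zero)) F (d ∷ γ)
                              ⊠ ∏embed (Fin.suc ∘ g ∘ Fin.suc) ((suc c ∸ d) ∷ zipWith _∸_ β γ)) (below β)} λ
    { zero    _ → psumMap-[] (λ γ → ℙ.trans (ℙ.*-cong (ℙ.refl {embed (g zero) F γ}) (∏embed-suc-suc (g ∘ Fin.suc) c (zipWith _∸_ β γ)))
                    (ℙ.zeroʳ (embed (g zero) F γ))) (below β)
    ; (suc d) _ → psumMap-[] (λ γ → ℙ.refl) (below β) })

  -- The later factors are free of the first variable, so in the convolution the first factor must
  -- supply its full power: only `c = a` survives.
  ∏embed-prodP : ∀ {k} (α : Vec ℕ k) → ∏embed (λ i → i) α ≋ prodP (λ i → F (Vec.lookup α i))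
  ∏embed-prodP []      = ℙ.refl
  ∏embed-prodP {suc k} (a ∷ α) = ℙ.trans (psumMap-below _ a α) (ℙ.trans (psum<-last a (λ c → psumMap (term c) (below α)))
    (ℙ.trans (ℙ.+-cong (psum<-[] a early) last)
      (ℙ.*-cong (ℙ.refl {F a}) (∏embed-prodP α))))
    where
    term : ℕ → Vec ℕ k → Poly
    term c β = (if isZeroVec β then F c else []) ⊠ ∏embed Fin.suc ((a ∸ c) ∷ zipWith _∸_ α β)
    early : ∀ c → c ℕ.< a → psumMap (term c) (below α) ≋ []
    early c c<a = psumMap-[] {f = term c} (λ β → ℙ.trans
      (ℙ.*-cong (ℙ.refl {if isZeroVec β then F c else []}) (vanish (ℕₚ.m<n⇒0<n∸m c<a) (zipWith _∸_ α β)))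
      (ℙ.zeroʳ (if isZeroVec β then F c else []))) (below α)
      where
      vanish : ∀ {d} → 0 ℕ.< d → ∀ (β : Vec ℕ k) → ∏embed Fin.suc (d ∷ β) ≋ []
      vanish {suc d} (s≤s z≤n) β = ∏embed-suc-suc (λ i → i) d β
    last : psumMap (term a) (below α) ≋ F a ⊠ ∏embed (λ i → i) α
    last = ℙ.trans (psumMap-cong {f = term a} (λ β → ℙ.*-cong (ℙ.refl {if isZeroVec β then F a else []})
        (ℙ.trans (ℙ.reflexive (cong (λ d → ∏embed Fin.suc (d ∷ zipWith _∸_ α β)) (ℕₚ.n∸n≡0 a)))
          (∏embed-suc-zero (λ i → i) (zipWith _∸_ α β)))) (below α))
      (psumMap-isZeroVec (F a) (∏embed (λ i → i)) α)

-- Correctness of the automaton on words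

open Unmatched using (δ; value; weight; sum-weight)

module _ {k : ℕ} (x : Fin k) where

  run : State → Bool → List (Fin k) → State
  run s f []      = s
  run s f (c ∷ w) = if on (just c) x then run (δ f s) true w else run s false w

  -- Embedding L w: w has disjoint factors x^m, m running through L, in this order.
  data Embedding : List ℕ → List (Fin k) → Set
  data Prefix : ℕ → List ℕ → List (Fin k) → Set

  data Embedding where
    finished : ∀ {w} → Embedding [] w
    skip     : ∀ {L c w} → Embedding L w → Embedding L (c ∷ w)
    block    : ∀ {m L w} → Prefix m L w → Embedding (m ∷ L) w

  data Prefix where
    end  : ∀ {L w} → Embedding L w → Prefix 0 L w
    read : ∀ {r L w} → Prefix r L w → Prefix (suc r) L (x ∷ w)

  Prefix⇒Embedding : ∀ {r L w} → Prefix r L w → Embedding L w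
  Prefix⇒Embedding (end e)  = e
  Prefix⇒Embedding (read p) = skip (Prefix⇒Embedding p)

  drop-block : ∀ {m L w} → Embedding (m ∷ L) w → Embedding L w
  drop-block (skip e)  = skip (drop-block e)
  drop-block (block p) = Prefix⇒Embedding p

  shorten : ∀ {r r′ L w} → r′ ≤ r → Prefix r L w → Prefix r′ L w
  shorten z≤n      p        = end (Prefix⇒Embedding p)
  shorten (s≤s le) (read p) = read (shorten le p)

  run-done : ∀ f w → run done f w ≡ done
  run-done f []      = refl
  run-done f (c ∷ w) with c Fin.≟ x
  run-done false (c ∷ w) | yes _ = run-done true w
  run-done true  (c ∷ w) | yes _ = run-done true w
  ... | no  _ = run-done false w

  -- The alternative reflects the fate of the open run: it lasts long enough to complete the current
  -- block, or the block is matched from scratch later.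
  sound-run : ∀ r m ms w → run (at r m ms) true w ≡ done →
              Prefix (suc r) (map suc ms) w ⊎ Embedding (map suc (m ∷ ms)) w
  sound-new : ∀ r m ms w → run (at r m ms) false w ≡ done → Embedding (map suc (m ∷ ms)) w
  sound-start : ∀ ms w → run (start ms) true w ≡ done → Embedding (map suc ms) w

  sound-run r m ms []      ()
  sound-run r m ms (c ∷ w) e with c Fin.≟ x
  ... | no _ = inj₂ (skip (sound-new r m ms w e))
  sound-run zero    m ms (c ∷ w) e | yes refl = inj₁ (read (end (sound-start ms w e)))
  sound-run (suc r) m ms (c ∷ w) e | yes refl with sound-run r m ms w e
  ... | inj₁ p = inj₁ (read p)
  ... | inj₂ i = inj₂ (skip i)

  sound-new r m ms []      ()
  sound-new r m ms (c ∷ w) e with c Fin.≟ x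
  ... | no _ = skip (sound-new r m ms w e)
  sound-new r zero    ms (c ∷ w) e | yes refl = block (read (end (sound-start ms w e)))
  sound-new r (suc m) ms (c ∷ w) e | yes refl with sound-run m (suc m) ms w e
  ... | inj₁ p = block (read p)
  ... | inj₂ i = skip i

  sound-start []       w e = finished
  sound-start (m ∷ ms) w e with sound-run m m ms w e
  ... | inj₁ p = block p
  ... | inj₂ i = i

  -- Greedy matching loses nothing. Since `r ≤ m`, an embedding that starts the block afresh reads
  -- at least as many letters as are still missing and can be cut down by `shorten`, or by
  -- `drop-block` once the block is complete.
  complete-run : ∀ r m ms w → r ≤ m → Prefix (suc r) (map suc ms) w ⊎ Embedding (map suc (m ∷ ms)) w →
                 run (at r m ms) true w ≡ done
  complete-new : ∀ r m ms w → Embedding (map suc (m ∷ ms)) w → run (at r m ms) false w ≡ done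
  complete-ext : ∀ r m ms w → r ≤ m → Prefix (suc r) (map suc ms) (x ∷ w) ⊎ Embedding (map suc (m ∷ ms)) (x ∷ w) →
                 run (ext (at r m ms)) true w ≡ done
  complete-start : ∀ ms w → Embedding (map suc ms) w → run (start ms) true w ≡ done

  complete-run r m ms []      le (inj₁ ())
  complete-run r m ms []      le (inj₂ (block ()))
  complete-run r m ms (c ∷ w) le h with c Fin.≟ x
  ... | yes refl = complete-ext r m ms w le h
  complete-run r m ms (c ∷ w) le (inj₁ (read _))         | no ne = contradiction refl ne
  complete-run r m ms (c ∷ w) le (inj₂ (block (read _))) | no ne = contradiction refl ne
  complete-run r m ms (c ∷ w) le (inj₂ (skip e))         | no ne = complete-new r m ms w e

  complete-new r m ms []      (block ())
  complete-new r m ms (c ∷ w) e with c Fin.≟ x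
  ... | yes refl = complete-ext m m ms w ℕₚ.≤-refl (inj₂ e)
  complete-new r m ms (c ∷ w) (block (read _)) | no ne = contradiction refl ne
  complete-new r m ms (c ∷ w) (skip e)         | no ne = complete-new r m ms w e

  complete-ext zero    m ms w le (inj₁ (read (end e)))   = complete-start ms w e
  complete-ext zero    m ms w le (inj₂ (skip e))         = complete-start ms w (drop-block e)
  complete-ext zero    m ms w le (inj₂ (block (read p))) = complete-start ms w (Prefix⇒Embedding p)
  complete-ext (suc r) m ms w le (inj₁ (read p))         = complete-run r m ms w (ℕₚ.<⇒≤ le) (inj₁ p)
  complete-ext (suc r) m ms w le (inj₂ (skip e))         = complete-run r m ms w (ℕₚ.<⇒≤ le) (inj₂ e)
  complete-ext (suc r) m ms w le (inj₂ (block (read p))) = complete-run r m ms w (ℕₚ.<⇒≤ le) (inj₁ (shorten le p))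

  complete-start []       w e = run-done true w
  complete-start (m ∷ ms) w e = complete-run m m ms w ℕₚ.≤-refl (inj₂ e)

-- Occurrences as index functions

-- Positions are natural numbers, so that dropping a letter is a mere predecessor; being inside the
-- word is part of `At`, which is empty beyond the end.
At : ∀ {k} → List (Fin k) → ℕ → Fin k → Set
At []      n       x = ⊥
At (c ∷ w) zero    x = c ≡ x
At (c ∷ w) (suc n) x = At w n x

At-lookup : ∀ {k} (w : List (Fin k)) i → At w (toℕ i) (lookup w i)
At-lookup (c ∷ w) zero    = refl
At-lookup (c ∷ w) (suc i) = At-lookup w i

At⇒index : ∀ {k} (w : List (Fin k)) n {x} → At w n x → ∃ λ (i : Fin (length w)) → toℕ i ≡ n × lookup w i ≡ x
At⇒index (c ∷ w) zero    e = zero , refl , e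
At⇒index (c ∷ w) (suc n) e with At⇒index w n e
... | i , i≡n , l = suc i , cong suc i≡n , l

boundariesFrom-suc : ∀ {n} a L → n ∈ boundariesFrom a L → suc n ∈ boundariesFrom (suc a) L
boundariesFrom-suc a (m ∷ m′ ∷ ms) (here refl) = here refl
boundariesFrom-suc a (m ∷ m′ ∷ ms) (there b)   = there (boundariesFrom-suc (a ℕ.+ m) (m′ ∷ ms) b)

boundariesFrom-pred : ∀ {n} a L → suc n ∈ boundariesFrom (suc a) L → n ∈ boundariesFrom a L
boundariesFrom-pred a (m ∷ m′ ∷ ms) (here refl) = here refl
boundariesFrom-pred a (m ∷ m′ ∷ ms) (there b)   = there (boundariesFrom-pred (a ℕ.+ m) (m′ ∷ ms) b)

boundariesFrom-≥ : ∀ {n} a m ms → n ∈ boundariesFrom a (m ∷ ms) → a ℕ.+ m ≤ n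
boundariesFrom-≥ a m (m′ ∷ ms) (here refl) = ℕₚ.≤-refl
boundariesFrom-≥ a m (m′ ∷ ms) (there b)   =
  ℕₚ.≤-trans (ℕₚ.m≤m+n (a ℕ.+ m) m′) (boundariesFrom-≥ (a ℕ.+ m) m′ ms b)

boundaries-suc : ∀ {n} r L → n ∈ boundaries (r ∷ L) → suc n ∈ boundaries (suc r ∷ L)
boundaries-suc r (m ∷ ms) (here refl) = here refl
boundaries-suc r (m ∷ ms) (there b)   = there (boundariesFrom-suc r (m ∷ ms) b)

boundaries-pred : ∀ {n} r L → suc n ∈ boundaries (suc r ∷ L) → n ∈ boundaries (r ∷ L)
boundaries-pred r (m ∷ ms) (here refl) = here refl
boundaries-pred r (m ∷ ms) (there b)   = there (boundariesFrom-pred r (m ∷ ms) b)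

boundaries-0∷ : ∀ {n} L → n ∈ boundaries L → n ∈ boundaries (0 ∷ L)
boundaries-0∷ (m ∷ ms) b = there b

-- An exhausted first block adds only the boundary 0, which `suc n` excludes.
boundaries-0∷⁻¹ : ∀ {n} L → suc n ∈ boundaries (0 ∷ L) → suc n ∈ boundaries L
boundaries-0∷⁻¹ (m ∷ ms) (there b) = b

record Occurrence {k} (x : Fin k) (L : List ℕ) (w : List (Fin k)) (i : Fin (sumℕ L) → ℕ) : Set where
  field
    increasing : ∀ j j′ → j Fin.< j′ → i j < i j′
    letter     : ∀ j → At w (i j) x
    adjacent   : ∀ j j′ → toℕ j′ ≡ suc (toℕ j) → suc (toℕ j) ∉ boundaries L → i j′ ≡ suc (i j)

open Occurrence

module _ {k : ℕ} {x : Fin k} where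

  embedding⇒occurrence : ∀ {L w} → Embedding x L w → ∃ (Occurrence x L w)
  -- The last component strengthens the induction: it places the next letter of the block directly
  -- behind the one being added.
  prefix⇒occurrence : ∀ {r L w} → Prefix x r L w →
    ∃ λ i → Occurrence x (r ∷ L) w i × (∀ j → toℕ j < r → i j ≡ toℕ j)

  embedding⇒occurrence finished  = (λ ()) , record { increasing = λ () ; letter = λ () ; adjacent = λ () }
  embedding⇒occurrence (skip e)  with embedding⇒occurrence e
  ... | i , o = (suc ∘ i) , record
    { increasing = λ j j′ lt → s≤s (increasing o j j′ lt)
    ; letter     = letter o
    ; adjacent   = λ j j′ e nb → cong suc (adjacent o j j′ e nb) }
  embedding⇒occurrence (block p) with prefix⇒occurrence p
  ... | i , o , _ = i , o

  prefix⇒occurrence {L = L} (end e) with embedding⇒occurrence e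
  ... | i , o = i , record
    { increasing = increasing o
    ; letter     = letter o
    ; adjacent   = λ j j′ e nb → adjacent o j j′ e (nb ∘ boundaries-0∷ L) } , λ _ ()
  prefix⇒occurrence {suc r} {L} (read {w = w} p) with prefix⇒occurrence p
  ... | i , o , initial = i⁺ , record { increasing = inc ; letter = let′ ; adjacent = adj } , init
    where
    i⁺ : Fin (suc (sumℕ (r ∷ L))) → ℕ
    i⁺ zero    = 0
    i⁺ (suc j) = suc (i j)
    inc : ∀ j j′ → j Fin.< j′ → i⁺ j < i⁺ j′
    inc zero    (suc j′) lt       = s≤s z≤n
    inc (suc j) (suc j′) (s≤s lt) = s≤s (increasing o j j′ lt)
    let′ : ∀ j → At (x ∷ w) (i⁺ j) x
    let′ zero    = refl
    let′ (suc j) = letter o j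
    first : ∀ r L (i : Fin (sumℕ (r ∷ L)) → ℕ) → (∀ j → toℕ j < r → i j ≡ toℕ j) →
            ∀ j → toℕ j ≡ 0 → 1 ∉ boundaries (suc r ∷ L) → i j ≡ 0
    -- With `r = 0` the added letter is the whole block, so 1 is a boundary.
    first zero    (m ∷ L) i h j e nb = contradiction (here refl) nb
    first (suc r) L       i h j e nb = trans (h j (subst (_< suc r) (sym e) (s≤s z≤n))) e
    adj : ∀ j j′ → toℕ j′ ≡ suc (toℕ j) → suc (toℕ j) ∉ boundaries (suc r ∷ L) → i⁺ j′ ≡ suc (i⁺ j)
    adj zero    (suc j′) e nb = cong suc (first r L i initial j′ (ℕₚ.suc-injective e) nb)
    adj (suc j) (suc j′) e nb = cong suc (adjacent o j j′ (ℕₚ.suc-injective e) (nb ∘ boundaries-suc r L))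
    init : ∀ j → toℕ j < suc r → i⁺ j ≡ toℕ j
    init zero    lt       = refl
    init (suc j) (s≤s lt) = cong suc (initial j lt)

  -- Blocks of the form `suc m` guarantee a first index, and its position decides: at 0 the first
  -- block starts here, otherwise all positions are positive and the first letter of the word can be
  -- skipped.
  occurrence⇒embedding : ∀ ms w {i} → Occurrence x (map suc ms) w i → Embedding x (map suc ms) w
  occurrence⇒prefix : ∀ r ms w {i} → Occurrence x (r ∷ map suc ms) w i → (∀ j → toℕ j < r → i j ≡ toℕ j) →
    Prefix x r (map suc ms) w
  occurrence⇒skip : ∀ m ms w {i} → Occurrence x (map suc (m ∷ ms)) w i → ∀ {n} → i zero ≡ suc n →
    Embedding x (map suc (m ∷ ms)) w

  occurrence⇒embedding []       w       o = finished
  occurrence⇒embedding (m ∷ ms) w {i} o with i zero in i0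
  ... | suc n = occurrence⇒skip m ms w o i0
  ... | zero  = block (occurrence⇒prefix (suc m) ms w o λ j → initial (toℕ j) j refl)
    where
    -- The recursion is on `n` because `Fin.inject₁ j` is not a subterm of `suc j`.
    initial : ∀ n j → toℕ j ≡ n → toℕ j < suc m → i j ≡ toℕ j
    initial zero    zero    e lt = i0
    initial (suc n) (suc j) e lt = trans (adjacent o (Fin.inject₁ j) (suc j) (cong suc (sym (toℕ-inject₁ j))) inner)
      (cong suc (trans (initial n (Fin.inject₁ j) (trans (toℕ-inject₁ j) (ℕₚ.suc-injective e))
        (subst (_< suc m) (sym (toℕ-inject₁ j)) (ℕₚ.<⇒≤ lt))) (toℕ-inject₁ j)))
      where
      inner : suc (toℕ (Fin.inject₁ j)) ∉ boundaries (suc m ∷ map suc ms)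
      inner b = ℕₚ.<⇒≱ lt (subst (λ z → suc m ≤ suc z) (toℕ-inject₁ j) (boundariesFrom-≥ 0 (suc m) (map suc ms) b))

  occurrence⇒skip m ms []      o i0 = ⊥-elim (letter o zero)
  occurrence⇒skip m ms (c ∷ w) {i} o i0 = skip (occurrence⇒embedding (m ∷ ms) w record
    { increasing = λ j j′ lt → ℕ.s≤s⁻¹ (subst₂ _<_ (shift j) (shift j′) (increasing o j j′ lt))
    ; letter     = λ j → subst (λ z → At (c ∷ w) z x) (shift j) (letter o j)
    ; adjacent   = λ j j′ e nb → cong pred (trans (adjacent o j j′ e nb) (cong suc (shift j))) })
    where
    shift : ∀ j → i j ≡ suc (pred (i j))
    shift zero    rewrite i0 = refl
    shift (suc j) = sym (ℕₚ.suc-pred (i (suc j)) {{ℕ.>-nonZero (ℕₚ.≤-<-trans z≤n (increasing o zero (suc j) (s≤s z≤n)))}})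

  occurrence⇒prefix zero    ms w o initial = end (occurrence⇒embedding ms w record
    { increasing = increasing o
    ; letter     = letter o
    ; adjacent   = λ j j′ e nb → adjacent o j j′ e (nb ∘ boundaries-0∷⁻¹ (map suc ms)) })
  occurrence⇒prefix (suc r) ms []      o initial = ⊥-elim (letter o zero)
  occurrence⇒prefix (suc r) ms (c ∷ w) {i} o initial
    with refl ← subst (λ z → At (c ∷ w) z x) (initial zero (s≤s z≤n)) (letter o zero) =
    read (occurrence⇒prefix r ms w {λ j → pred (i (suc j))} record
      { increasing = λ j j′ lt → ℕ.s≤s⁻¹ (subst₂ _<_ (shift j) (shift j′) (increasing o (suc j) (suc j′) (s≤s lt)))
      ; letter     = λ j → subst (λ z → At (c ∷ w) z x) (shift j) (letter o (suc j))
      ; adjacent   = λ j j′ e nb → cong pred (trans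
          (adjacent o (suc j) (suc j′) (cong suc e) (nb ∘ boundaries-pred r (map suc ms))) (cong suc (shift j))) }
      (λ j lt → cong pred (initial (suc j) (s≤s lt))))
    where
    shift : ∀ j → i (suc j) ≡ suc (pred (i (suc j)))
    shift j = sym (ℕₚ.suc-pred (i (suc j)) {{ℕ.>-nonZero (ℕₚ.≤-<-trans z≤n (increasing o zero (suc j) (s≤s z≤n)))}})

module _ {k : ℕ} (m : ℕ) (ms : List ℕ) (w : List (Fin k)) where

  contains⇒done : Contains (map suc (m ∷ ms)) w → ∃ λ x → run x (at m m ms) false w ≡ done
  contains⇒done (i , inc , same , adj) = lookup w (i zero) ,
    complete-new (lookup w (i zero)) m m ms w (occurrence⇒embedding (m ∷ ms) w {toℕ ∘ i} record
      { increasing = inc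
      ; letter     = λ j → subst (At w (toℕ (i j))) (same j zero) (At-lookup w (i j))
      ; adjacent   = adj })

  done⇒contains : ∀ x → run x (at m m ms) false w ≡ done → Contains (map suc (m ∷ ms)) w
  done⇒contains x e with embedding⇒occurrence (sound-new x m m ms w e)
  ... | i , o = proj₁ ∘ index
    , (λ j j′ lt → subst₂ _<_ (sym (position j)) (sym (position j′)) (increasing o j j′ lt))
    , (λ j j′ → trans (proj₂ (proj₂ (index j))) (sym (proj₂ (proj₂ (index j′)))))
    , (λ j j′ e nb → trans (position j′) (trans (adjacent o j j′ e nb) (cong suc (sym (position j)))))
    where
    index : ∀ j → ∃ λ (f : Fin (length w)) → toℕ f ≡ i j × lookup w f ≡ x
    index j = At⇒index w (i j) (letter o j)
    position : ∀ j → toℕ (proj₁ (index j)) ≡ i j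
    position j = proj₁ (proj₂ (index j))

-- From automaton weights to the number of avoiding words

module _ {k : ℕ} (x : Fin k) where

  value-≡ : ∀ s f a w → occ x w ≡ a → value x s f a w ≡ unmatched (run x s f w)
  value-≡ s f zero    []      e = refl
  -- `occ` decides `x ≟ c` while `value` and `run` decide `c ≟ x`; both are split and the mixed
  -- cases refuted.
  value-≡ s f a       (c ∷ w) e with x Fin.≟ c | c Fin.≟ x
  value-≡ s f (suc a) (c ∷ w) e | yes _    | yes _  = value-≡ (δ f s) true a w (ℕₚ.suc-injective e)
  value-≡ s f a       (c ∷ w) e | yes x≡c  | no c≢x = contradiction (sym x≡c) c≢x
  value-≡ s f a       (c ∷ w) e | no x≢c   | yes c≡x = contradiction (sym c≡x) x≢c
  value-≡ s f a       (c ∷ w) e | no _     | no _   = value-≡ s false a w e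

  value-≢ : ∀ s f a w → occ x w ≢ a → value x s f a w ≡ 0ℚ
  value-≢ s f zero    []      ne = contradiction refl ne
  value-≢ s f (suc a) []      ne = refl
  value-≢ s f a       (c ∷ w) ne with x Fin.≟ c | c Fin.≟ x
  value-≢ s f zero    (c ∷ w) ne | yes _    | yes _  = refl
  value-≢ s f (suc a) (c ∷ w) ne | yes _    | yes _  = value-≢ (δ f s) true a w (ne ∘ cong suc)
  value-≢ s f a       (c ∷ w) ne | yes x≡c  | no c≢x = contradiction (sym x≡c) c≢x
  value-≢ s f a       (c ∷ w) ne | no x≢c   | yes c≡x = contradiction (sym c≡x) x≢c
  value-≢ s f a       (c ∷ w) ne | no _     | no _   = value-≢ s false a w ne

prodℚ-one : ∀ {k} (f : Fin k → ℚ) → (∀ x → f x ≡ 1ℚ) → prodℚ f ≡ 1ℚ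
prodℚ-one {zero}  f e = refl
prodℚ-one {suc k} f e = trans (cong₂ _*_ (e zero) (prodℚ-one (f ∘ suc) (e ∘ suc))) (ℚₚ.*-identityˡ 1ℚ)

length-filter : ∀ {A : Set} {P : A → Set} (P? : ∀ a → Dec (P a)) (f : A → ℚ) →
  (∀ a → P a → f a ≡ 1ℚ) → (∀ a → ¬ P a → f a ≡ 0ℚ) → ∀ as → ℕtoℚ (length (filter P? as)) ≡ sumList f as
length-filter P? f one zero′ []       = refl
length-filter P? f one zero′ (a ∷ as) with P? a
... | yes p = trans (ℕtoℚ-homo-+ 1 (length (filter P? as))) (cong₂ _+_ (sym (one a p)) (length-filter P? f one zero′ as))
... | no ¬p = trans (sym (ℚₚ.+-identityˡ (ℕtoℚ (length (filter P? as))))) (cong₂ _+_ (sym (zero′ a ¬p)) (length-filter P? f one zero′ as))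

unmatched-≢ : ∀ s → s ≢ done → unmatched s ≡ 1ℚ
unmatched-≢ done       ne = contradiction refl ne
unmatched-≢ (at _ _ _) ne = refl

done? : ∀ s → Dec (s ≡ done)
done? done       = yes refl
done? (at _ _ _) = no λ ()

total-lookup : ∀ {k} (α : Vec ℕ k) → total (Vec.lookup α) ≡ Vec.sum α
total-lookup []      = refl
total-lookup (a ∷ α) = cong (a ℕ.+_) (total-lookup α)

module _ {k : ℕ} (m : ℕ) (ms : List ℕ) (α : Vec ℕ k) where

  -- Each factor of the weight is 0 or 1 and checks both the number of occurrences of its letter and
  -- that this letter does not complete the pattern.
  indicator : List (Fin k) → ℚ
  indicator = weight nothing (λ _ → at m m ms) (Vec.lookup α)

  indicator-one : ∀ w → Avoids (map suc (m ∷ ms)) w × content w ≡ α → indicator w ≡ 1ℚ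
  indicator-one w (avoids , content≡α) = prodℚ-one _ λ x → trans
    (value-≡ x (at m m ms) false (Vec.lookup α x) w
      (trans (sym (lookup∘tabulate (λ c → occ c w) x)) (cong (λ v → Vec.lookup v x) content≡α)))
    (unmatched-≢ (run x (at m m ms) false w) (avoids ∘ done⇒contains m ms w x))

  indicator-zero : ∀ w → ¬ (Avoids (map suc (m ∷ ms)) w × content w ≡ α) → indicator w ≡ 0ℚ
  indicator-zero w ¬p with any? (λ x → done? (run x (at m m ms) false w)) | ≡-dec ℕ._≟_ (content w) α
  ... | no ¬done | yes content≡α = contradiction ((¬done ∘ contains⇒done m ms w) , content≡α) ¬p
  ... | yes (x , e) | yes content≡α = prodℚ-zero _ x (trans
    (value-≡ x (at m m ms) false (Vec.lookup α x) w
      (trans (sym (lookup∘tabulate (λ c → occ c w) x)) (cong (λ v → Vec.lookup v x) content≡α)))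
    (cong unmatched e))
  ... | _ | no content≢α with ¬∀⟶∃¬ k (λ x → occ x w ≡ Vec.lookup α x) (λ x → occ x w ℕ.≟ Vec.lookup α x)
                               (λ h → content≢α (trans (tabulate-cong h) (tabulate∘lookup α)))
  ... | x , ne = prodℚ-zero _ x (value-≢ x (at m m ms) false (Vec.lookup α x) w ne)

  avoiders : (dec : ∀ w → Dec (Avoids (map suc (m ∷ ms)) w)) →
    ℕtoℚ (lhsCoeff (map suc (m ∷ ms)) dec α) ≡ rhsCoeff k (suc m) (map suc ms) α
  avoiders dec = begin
    ℕtoℚ (lhsCoeff (map suc (m ∷ ms)) dec α)
      ≡⟨ length-filter (λ w → dec w ×-dec ≡-dec ℕ._≟_ (content w) α) indicator indicator-one indicator-zero (allWords k (Vec.sum α)) ⟩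
    sumList indicator (allWords k (Vec.sum α))
      ≡⟨ sum-weight (Vec.sum α) nothing (λ _ → at m m ms) (Vec.lookup α) (total-lookup α) ⟩
    Φ (prodP (λ x → Unmatched.TA (at m m ms) (Vec.lookup α x)))
      ≡⟨ Φ-cong (prodP-cong (λ x → factorCoeff-TA m ms (Vec.lookup α x))) ⟨
    Φ (prodP (λ x → factorCoeff (suc m) (map suc ms) (Vec.lookup α x)))
      ≡⟨ Φ-cong (∏embed-prodP (factorCoeff (suc m) (map suc ms)) α) ⟨
    rhsCoeff k (suc m) (map suc ms) α ∎

positive⇒map-suc : ∀ {ms} → All (λ m → 0 < m) ms → ∃ λ ps → map suc ps ≡ ms
positive⇒map-suc []       = [] , refl
positive⇒map-suc (_∷_ {suc p} _ pos) with positive⇒map-suc pos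
... | ps , e = p ∷ ps , cong (suc p ∷_) e

theorem4p1 : (m₁ : ℕ) (ms : List ℕ) → All (λ m → 0 < m) (m₁ ∷ ms) →
    (k : ℕ) → 0 < k →
    (dec : (w : List (Fin k)) → Dec (Avoids (m₁ ∷ ms) w)) →
    (α : Vec ℕ k) →
    ℕtoℚ (lhsCoeff (m₁ ∷ ms) dec α) ≡ rhsCoeff k m₁ ms α
theorem4p1 (suc m) ms (_ ∷ pos) k _ dec α with positive⇒map-suc pos
... | ps , refl = avoiders m ps α dec
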